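{- Let $p$ be a prime, let $m\geq2$ be an integer with $\gcd(p,m)=1$, and let $k$ be a nonnegative integer. Then $$\Psi_{p^km}(x)\equiv\Psi_m(x)^{\varphi(p^k)}\pmod p.$$
   Context: $\varphi$ is Euler's totient function. The Fibonacci polynomials are defined by $F_1(x)=1$, $F_2(x)=x$, and $F_n(x)=xF_{n-1}(x)+F_{n-2}(x)$ for $n\geq 3$. For $n\geq 2$, the $n$-th fibotomic polynomial $\Psi_n(x)\in\mathbb{Z}[x]$ is the product of the monic irreducible factors (in $\mathbb{Z}[x]$) of $F_n(x)$ which are not factors of $F_k(x)$ for any $k<n$; $\Psi_1(x)=1$. Congruence modulo $p$ of integer polynomials means equality of their reductions in $\mathbb{Z}_p[x]$. -}

module Defs where

open import Data.Nat as ℕ using (ℕ; zero; suc; _≤_; _<_)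
open import Data.Nat.GCD using (gcd)
open import Data.Integer as ℤ using (ℤ; +_; -[1+_])
open import Data.Integer.Divisibility as ℤD using ()
open import Data.List using (List; []; _∷_; map; foldr; length; filter; applyUpTo)
open import Data.List.Relation.Unary.Any using (Any)
open import Data.List.Relation.Unary.All using (All)
open import Data.List.Relation.Unary.AllPairs using (AllPairs)
open import Data.Product using (Σ; ∃; _×_)
open import Data.Sum using (_⊎_)
open import Relation.Nullary using (¬_)
open import Relation.Binary.PropositionalEquality using (_≡_)
open import Function.Bundles using (_⇔_)

-- Integer polynomials as coefficient lists, lowest degree first.
-- Trailing zeros are allowed; equality is coefficientwise (≈ₚ).
Poly : Set
Poly = List ℤ

coeff : Poly → ℕ → ℤ
coeff []      _       = + 0
coeff (a ∷ P) zero    = a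
coeff (a ∷ P) (suc i) = coeff P i

_≈ₚ_ : Poly → Poly → Set
P ≈ₚ Q = ∀ i → coeff P i ≡ coeff Q i

infix 4 _≈ₚ_

_+ₚ_ : Poly → Poly → Poly
[]      +ₚ Q       = Q
(a ∷ P) +ₚ []      = a ∷ P
(a ∷ P) +ₚ (b ∷ Q) = (a ℤ.+ b) ∷ (P +ₚ Q)

_*ₚ_ : Poly → Poly → Poly
[]      *ₚ Q = []
(a ∷ P) *ₚ Q = map (a ℤ.*_) Q +ₚ (+ 0 ∷ (P *ₚ Q))

oneₚ : Poly
oneₚ = + 1 ∷ []

xmul : Poly → Poly
xmul P = + 0 ∷ P

_^ₚ_ : Poly → ℕ → Poly
P ^ₚ zero  = oneₚ
P ^ₚ suc n = P *ₚ (P ^ₚ n)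

prodₚ : List Poly → Poly
prodₚ = foldr _*ₚ_ oneₚ

_∣ₚ_ : Poly → Poly → Set
Q ∣ₚ P = ∃ λ A → P ≈ₚ Q *ₚ A

Monic : Poly → Set
Monic P = ∃ λ d → coeff P d ≡ + 1 × (∀ i → d < i → coeff P i ≡ + 0)

IsUnit : Poly → Set
IsUnit P = P ≈ₚ (+ 1 ∷ []) ⊎ P ≈ₚ (-[1+ 0 ] ∷ [])

Irreducible : Poly → Set
Irreducible Q = (¬ IsUnit Q) × (¬ Q ≈ₚ []) ×
  (∀ A B → Q ≈ₚ A *ₚ B → IsUnit A ⊎ IsUnit B)

-- Fibonacci polynomials F_n (n ≥ 1); F 0 is an unused filler value.
F : ℕ → Poly
F zero                = []
F (suc zero)          = oneₚ
F (suc (suc zero))    = xmul oneₚ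
F (suc (suc (suc n))) = xmul (F (suc (suc n))) +ₚ F (suc n)

NewFactor : ℕ → Poly → Set
NewFactor n Q = Q ∣ₚ F n × (∀ k → 1 ≤ k → k < n → ¬ (Q ∣ₚ F k))

IsFibotomic : ℕ → Poly → Set
IsFibotomic n P =
  (n ≡ 1 × P ≈ₚ oneₚ) ⊎
  (2 ≤ n × Σ (List Poly) λ Qs →
      P ≈ₚ prodₚ Qs
    × All (λ Q → Monic Q × Irreducible Q) Qs
    × AllPairs (λ A B → ¬ A ≈ₚ B) Qs
    × (∀ Q → Monic Q → Irreducible Q →
         (Any (λ R → R ≈ₚ Q) Qs ⇔ NewFactor n Q)))

CongMod : ℕ → Poly → Poly → Set
CongMod p P Q = ∀ i → (+ p) ℤD.∣ (coeff P i ℤ.- coeff Q i)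

φ : ℕ → ℕ
φ n = length (filter (λ i → gcd i n ℕ.≟ 1) (applyUpTo suc n))

{-# OPTIONS --safe #-}
-- In ℤ[x] one has Fₙ = ∏_{d ∣ n} Ψ_d: monic irreducibles are prime (Gauss), an irreducible divides
-- Fₙ exactly when the first index d with Q ∣ F_d divides n, and Fₙ is squarefree by the formula for
-- (x² + 4) Fₙ′. Hence F_{pʲ⁺¹m} = F_{pʲm} ∏_{d ∣ m} Ψ_{pʲ⁺¹d} for p ∤ m. Modulo p the binomial theorem
-- applied to αⁿ = Fₙ α + Fₙ₋₁ gives F_{pn} ≡ Fₙᵖ F_p, so F_{pᵏm} ≡ F_{pᵏ} F_m^{pᵏ}. Comparing the two
-- for m and for 1 gives ∏_{d ∣ m, d > 1} Ψ_{pʲ⁺¹d} ≡ F_m^φ(pʲ⁺¹), and induction on m with cancellation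
-- isolates the factor d = m.
-- Irreducibility is not decided: factorisations exist up to double negation, which suffices
-- because divisibility of integers by p is decidable.
module Submission where

open import Defs hiding (_+ₚ_; _*ₚ_; _^ₚ_; _∣ₚ_)
open import Defs using () renaming (_+ₚ_ to infixl 6 _+ₚ_; _*ₚ_ to infixl 7 _*ₚ_; _^ₚ_ to infixr 8 _^ₚ_; _∣ₚ_ to infix 4 _∣ₚ_)
open import Algebra.Bundles using (CommutativeRing)
open import Data.Nat as ℕ using (ℕ; zero; suc; _≤_; _<_; z≤n; s≤s; NonZero)
open import Data.Nat using (_*_; _^_)
open import Data.Nat.GCD using (gcd; gcd[m,n]∣m; gcd[m,n]∣n; gcd-greatest)
import Data.Nat.Properties as ℕₚ
import Data.Nat.Divisibility as ℕᵈ
open import Data.Nat.Primality using (Prime; euclidsLemma; prime⇒nonZero; prime⇒nonTrivial)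
open import Data.Nat.Primality.Factorisation using (factorise; PrimeFactorisation)
open import Data.Nat.ListAction using (product)
open import Data.Integer as ℤ using (ℤ; +_; -[1+_]; ∣_∣)
import Data.Integer.Properties as ℤₚ
open import Data.Integer.Divisibility.Signed using (_∣_; divides; ∣ᵤ⇒∣; ∣⇒∣ᵤ; ∣m∣n⇒∣m+n; ∣m⇒∣-m; ∣n⇒∣m*n; ∣m⇒∣m*n; 0∣⇒≡0)
import Data.Integer.Tactic.RingSolver as ℤSolver
open import Data.List using (List; []; _∷_; map; _++_; concatMap; filter; applyUpTo; length)
open import Data.List.Properties using (filter-++; filter-accept; filter-reject; length-++; applyUpTo-∷ʳ)
open import Data.List.Membership.Propositional.Properties using (∈-filter⁺; ∈-filter⁻; ∈-applyUpTo⁺; ∈-applyUpTo⁻; ∈-map⁺; ∈-map⁻; ∈-++⁺ˡ; ∈-++⁺ʳ; ∈-++⁻)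
open import Data.List.Relation.Unary.All as All using (All; []; _∷_)
open import Data.List.Relation.Unary.Any as Any using (Any; here; there)
open import Data.List.Relation.Unary.AllPairs as AllPairs using (AllPairs; []; _∷_)
open import Data.List.Membership.Propositional using (_∈_)
open import Data.List.Relation.Unary.Unique.Propositional using (Unique)
import Data.List.Relation.Unary.Unique.Propositional.Properties as Unique
import Data.List.Relation.Unary.All.Properties as All
import Data.List.Relation.Unary.AllPairs.Properties as AllPairs
open import Data.Maybe using (Maybe; just; nothing)
open import Data.Empty using (⊥; ⊥-elim)
open import Data.Product using (∃; _×_; _,_; proj₁; proj₂)
open import Data.Sum as Sum using (_⊎_; inj₁; inj₂; [_,_]′)
open import Function using (_∘_; case_of_)
open import Function.Bundles using (_⇔_; mk⇔; Equivalence)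
open import Level using (0ℓ)
open import Relation.Nullary using (¬_; Dec; yes; no; contradiction; _⊎-dec_)
open import Relation.Nullary.Negation using (¬¬-map)
open import Relation.Nullary.Decidable using (decidable-stable; ¬¬-excluded-middle; map′)
open import Relation.Binary.PropositionalEquality as ≡ using (_≡_; _≢_; refl; cong; cong₂; subst)
open import Relation.Binary.Bundles using (Setoid)
import Relation.Binary.Reasoning.Setoid as SetoidReasoning
open import Tactic.RingSolver using (solve-∀)
open import Tactic.RingSolver.Core.AlmostCommutativeRing using (AlmostCommutativeRing; fromCommutativeRing)

-- The theorem speaks of two fibotomic polynomials only, at `p^k m` and at `m`, but the argument
-- needs the factors of `F d` for every `d ∣ p^k m`. Lists are therefore chosen for all indices up
-- to `p^k m` at once and matched with the two given ones by uniqueness. Put `s = p^(j+1)`,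
-- `r = p^j`, `e = s - r`, and let `H` be the product of the `Ψ_(s d)` over `d ∣ m`. Modulo `p`, `F
-- r · (F m)^r · H ≡ F (s m) ≡ F s · (F m)^s = F r · Ψ_s · (F m)^(e+r)`, and cancelling `F r · (F
-- m)^r` leaves `H ≡ Ψ_s · (F m)^e`. The index `d =
-- 1` is the exception to the congruence: `Ψ_s` is monic of positive degree while `Ψ_1 =
-- 1`. Hence `Ψ_s` is carried along on both sides and cancelled, and the induction concerns `m ≥ 2`
-- only. Everything cancelled is monic, so nonzero in the domain `𝔽_p[x]`. One relation with a
-- modulus `q` serves both rings: identities are proved at `q = 0` by the ring solver and then
-- reduced modulo `p`.

-- Integers modulo q

record ModEq (q : ℕ) (a b : ℤ) : Set where
  constructor modEq
  field diff : + q ∣ a ℤ.- b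

≡⇒ModEq : ∀ {q a b} → a ≡ b → ModEq q a b
≡⇒ModEq {a = a} refl = modEq (divides (+ 0) (ℤₚ.+-inverseʳ a))

ModEq-0 : ∀ {a b} → ModEq 0 a b → a ≡ b
ModEq-0 (modEq d) = ℤₚ.i-j≡0⇒i≡j _ _ (0∣⇒≡0 d)

ℤmod : ℕ → CommutativeRing 0ℓ 0ℓ
ℤmod q = record
  { Carrier = ℤ ; _≈_ = ModEq q ; _+_ = ℤ._+_ ; _*_ = ℤ._*_ ; -_ = ℤ.-_ ; 0# = + 0 ; 1# = + 1
  ; isCommutativeRing = record
    { isRing = record
      { +-isAbelianGroup = record
        { isGroup = record
          { isMonoid = record
            { isSemigroup = record
              { isMagma = record
                { isEquivalence = record { refl = ≡⇒ModEq refl ; sym = symm ; trans = transm }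
                ; ∙-cong = +-congm }
              ; assoc = λ a b c → ≡⇒ModEq (ℤₚ.+-assoc a b c) }
            ; identity = (λ a → ≡⇒ModEq (ℤₚ.+-identityˡ a)) , (λ a → ≡⇒ModEq (ℤₚ.+-identityʳ a)) }
          ; inverse = (λ a → ≡⇒ModEq (ℤₚ.+-inverseˡ a)) , (λ a → ≡⇒ModEq (ℤₚ.+-inverseʳ a))
          ; ⁻¹-cong = negm }
        ; comm = λ a b → ≡⇒ModEq (ℤₚ.+-comm a b) }
      ; *-cong = *-congm
      ; *-assoc = λ a b c → ≡⇒ModEq (ℤₚ.*-assoc a b c)
      ; *-identity = (λ a → ≡⇒ModEq (ℤₚ.*-identityˡ a)) , (λ a → ≡⇒ModEq (ℤₚ.*-identityʳ a))
      ; distrib = (λ a b c → ≡⇒ModEq (ℤₚ.*-distribˡ-+ a b c)) , (λ a b c → ≡⇒ModEq (ℤₚ.*-distribʳ-+ a b c)) }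
    ; *-comm = λ a b → ≡⇒ModEq (ℤₚ.*-comm a b) } }
  where
  symm : ∀ {a b} → ModEq q a b → ModEq q b a
  symm {a} {b} (modEq d) = modEq (subst (+ q ∣_) (lem a b) (∣m⇒∣-m d))
    where lem : ∀ a b → ℤ.- (a ℤ.- b) ≡ b ℤ.- a
          lem = ℤSolver.solve-∀
  transm : ∀ {a b c} → ModEq q a b → ModEq q b c → ModEq q a c
  transm {a} {b} {c} (modEq d) (modEq e) = modEq (subst (+ q ∣_) (lem a b c) (∣m∣n⇒∣m+n d e))
    where lem : ∀ a b c → (a ℤ.- b) ℤ.+ (b ℤ.- c) ≡ a ℤ.- c
          lem = ℤSolver.solve-∀
  +-congm : ∀ {a b c d} → ModEq q a b → ModEq q c d → ModEq q (a ℤ.+ c) (b ℤ.+ d)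
  +-congm {a} {b} {c} {d} (modEq e) (modEq f) = modEq (subst (+ q ∣_) (lem a b c d) (∣m∣n⇒∣m+n e f))
    where lem : ∀ a b c d → (a ℤ.- b) ℤ.+ (c ℤ.- d) ≡ (a ℤ.+ c) ℤ.- (b ℤ.+ d)
          lem = ℤSolver.solve-∀
  *-congm : ∀ {a b c d} → ModEq q a b → ModEq q c d → ModEq q (a ℤ.* c) (b ℤ.* d)
  *-congm {a} {b} {c} {d} (modEq e) (modEq f) =
    modEq (subst (+ q ∣_) (lem a b c d) (∣m∣n⇒∣m+n (∣m⇒∣m*n c e) (∣n⇒∣m*n b f)))
    where lem : ∀ a b c d → (a ℤ.- b) ℤ.* c ℤ.+ b ℤ.* (c ℤ.- d) ≡ a ℤ.* c ℤ.- b ℤ.* d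
          lem = ℤSolver.solve-∀
  negm : ∀ {a b} → ModEq q a b → ModEq q (ℤ.- a) (ℤ.- b)
  negm {a} {b} (modEq d) = modEq (subst (+ q ∣_) (lem a b) (∣m⇒∣-m d))
    where lem : ∀ a b → ℤ.- (a ℤ.- b) ≡ (ℤ.- a) ℤ.- (ℤ.- b)
          lem = ℤSolver.solve-∀

-- Modulus 0 gives ℤ[x] itself.
record PolyEq (q : ℕ) (P Q : Poly) : Set where
  constructor polyEq
  field at : ∀ i → ModEq q (coeff P i) (coeff Q i)
open PolyEq public

-- The polynomial ring over ℤ/q

-ₚ_ : Poly → Poly
-ₚ_ = map (λ a → ℤ.- a)

scale : ℤ → Poly → Poly
scale a = map (a ℤ.*_)

coeff-+ₚ : ∀ P Q i → coeff (P +ₚ Q) i ≡ coeff P i ℤ.+ coeff Q i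
coeff-+ₚ []      Q       i       = ≡.sym (ℤₚ.+-identityˡ _)
coeff-+ₚ (a ∷ P) []      i       = ≡.sym (ℤₚ.+-identityʳ _)
coeff-+ₚ (a ∷ P) (b ∷ Q) zero    = refl
coeff-+ₚ (a ∷ P) (b ∷ Q) (suc i) = coeff-+ₚ P Q i

coeff-scale : ∀ a P i → coeff (scale a P) i ≡ a ℤ.* coeff P i
coeff-scale a []      i       = ≡.sym (ℤₚ.*-zeroʳ a)
coeff-scale a (b ∷ P) zero    = refl
coeff-scale a (b ∷ P) (suc i) = coeff-scale a P i

coeff--ₚ : ∀ P i → coeff (-ₚ P) i ≡ ℤ.- coeff P i
coeff--ₚ []      i       = refl
coeff--ₚ (b ∷ P) zero    = refl
coeff--ₚ (b ∷ P) (suc i) = coeff--ₚ P i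

module _ {q : ℕ} where
  private
    module Z = CommutativeRing (ℤmod q)
    module ZR = SetoidReasoning Z.setoid

  ≈ₚ⇒PolyEq : ∀ {P Q} → P ≈ₚ Q → PolyEq q P Q
  ≈ₚ⇒PolyEq e = polyEq λ i → ≡⇒ModEq (e i)

  polyRefl : ∀ {P} → PolyEq q P P
  polyRefl = polyEq λ i → Z.refl

  polySym : ∀ {P Q} → PolyEq q P Q → PolyEq q Q P
  polySym e = polyEq λ i → Z.sym (at e i)

  polyTrans : ∀ {P Q R} → PolyEq q P Q → PolyEq q Q R → PolyEq q P R
  polyTrans e f = polyEq λ i → Z.trans (at e i) (at f i)

  ∷-cong : ∀ {a b P Q} → ModEq q a b → PolyEq q P Q → PolyEq q (a ∷ P) (b ∷ Q)
  ∷-cong e f = polyEq λ { zero → e ; (suc i) → at f i }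

  tail-cong : ∀ {a b P Q} → PolyEq q (a ∷ P) (b ∷ Q) → PolyEq q P Q
  tail-cong e = polyEq λ i → at e (suc i)

  tail≈0 : ∀ {a P} → PolyEq q (a ∷ P) [] → PolyEq q P []
  tail≈0 e = polyEq λ i → at e (suc i)

  0∷≈[] : ∀ {P} → PolyEq q P [] → PolyEq q (+ 0 ∷ P) []
  0∷≈[] e = polyEq λ { zero → Z.refl ; (suc i) → at e i }

  private
    pointwise₂ : ∀ P Q {R} → (∀ i → ModEq q (coeff P i ℤ.+ coeff Q i) (coeff R i)) → PolyEq q (P +ₚ Q) R
    pointwise₂ P Q h = polyEq λ i → Z.trans (≡⇒ModEq (coeff-+ₚ P Q i)) (h i)

  +ₚ-cong : ∀ {P P′ Q Q′} → PolyEq q P P′ → PolyEq q Q Q′ → PolyEq q (P +ₚ Q) (P′ +ₚ Q′)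
  +ₚ-cong {P} {P′} {Q} {Q′} e f = pointwise₂ P Q λ i →
    Z.trans (Z.+-cong (at e i) (at f i)) (≡⇒ModEq (≡.sym (coeff-+ₚ P′ Q′ i)))

  +ₚ-comm : ∀ P Q → PolyEq q (P +ₚ Q) (Q +ₚ P)
  +ₚ-comm P Q = pointwise₂ P Q λ i →
    Z.trans (Z.+-comm (coeff P i) (coeff Q i)) (≡⇒ModEq (≡.sym (coeff-+ₚ Q P i)))

  +ₚ-assoc : ∀ P Q R → PolyEq q ((P +ₚ Q) +ₚ R) (P +ₚ (Q +ₚ R))
  +ₚ-assoc P Q R = polyEq λ i → ≡⇒ModEq (let open ≡.≡-Reasoning in begin
    coeff ((P +ₚ Q) +ₚ R) i                    ≡⟨ coeff-+ₚ (P +ₚ Q) R i ⟩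
    coeff (P +ₚ Q) i ℤ.+ coeff R i             ≡⟨ cong (ℤ._+ coeff R i) (coeff-+ₚ P Q i) ⟩
    coeff P i ℤ.+ coeff Q i ℤ.+ coeff R i      ≡⟨ ℤₚ.+-assoc (coeff P i) (coeff Q i) (coeff R i) ⟩
    coeff P i ℤ.+ (coeff Q i ℤ.+ coeff R i)    ≡⟨ cong (λ c → coeff P i ℤ.+ c) (coeff-+ₚ Q R i) ⟨
    coeff P i ℤ.+ coeff (Q +ₚ R) i             ≡⟨ coeff-+ₚ P (Q +ₚ R) i ⟨
    coeff (P +ₚ (Q +ₚ R)) i                    ∎)

  +ₚ-identityʳ : ∀ P → PolyEq q (P +ₚ []) P
  +ₚ-identityʳ P = pointwise₂ P [] λ i → Z.+-identityʳ _

  -ₚ-cong : ∀ {P Q} → PolyEq q P Q → PolyEq q (-ₚ P) (-ₚ Q)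
  -ₚ-cong {P} {Q} e = polyEq λ i →
    Z.trans (≡⇒ModEq (coeff--ₚ P i)) (Z.trans (Z.-‿cong (at e i)) (≡⇒ModEq (≡.sym (coeff--ₚ Q i))))

  -ₚ-inverseʳ : ∀ P → PolyEq q (P +ₚ (-ₚ P)) []
  -ₚ-inverseʳ P = pointwise₂ P (-ₚ P) λ i →
    Z.trans (Z.+-congˡ {coeff P i} (≡⇒ModEq (coeff--ₚ P i))) (Z.-‿inverseʳ (coeff P i))

  scale-cong : ∀ {a b P Q} → ModEq q a b → PolyEq q P Q → PolyEq q (scale a P) (scale b Q)
  scale-cong {a} {b} {P} {Q} e f = polyEq λ i →
    Z.trans (≡⇒ModEq (coeff-scale a P i)) (Z.trans (Z.*-cong e (at f i)) (≡⇒ModEq (≡.sym (coeff-scale b Q i))))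

  scale-+ₚ : ∀ a P Q → PolyEq q (scale a (P +ₚ Q)) (scale a P +ₚ scale a Q)
  scale-+ₚ a P Q = polyEq λ i → ≡⇒ModEq (let open ≡.≡-Reasoning in begin
    coeff (scale a (P +ₚ Q)) i                   ≡⟨ coeff-scale a (P +ₚ Q) i ⟩
    a ℤ.* coeff (P +ₚ Q) i                       ≡⟨ cong (a ℤ.*_) (coeff-+ₚ P Q i) ⟩
    a ℤ.* (coeff P i ℤ.+ coeff Q i)              ≡⟨ ℤₚ.*-distribˡ-+ a _ _ ⟩
    a ℤ.* coeff P i ℤ.+ a ℤ.* coeff Q i          ≡⟨ cong₂ ℤ._+_ (coeff-scale a P i) (coeff-scale a Q i) ⟨
    coeff (scale a P) i ℤ.+ coeff (scale a Q) i  ≡⟨ coeff-+ₚ (scale a P) (scale a Q) i ⟨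
    coeff (scale a P +ₚ scale a Q) i             ∎)

  +-scale : ∀ a b P → PolyEq q (scale (a ℤ.+ b) P) (scale a P +ₚ scale b P)
  +-scale a b P = polyEq λ i → ≡⇒ModEq (let open ≡.≡-Reasoning in begin
    coeff (scale (a ℤ.+ b) P) i                  ≡⟨ coeff-scale (a ℤ.+ b) P i ⟩
    (a ℤ.+ b) ℤ.* coeff P i                      ≡⟨ ℤₚ.*-distribʳ-+ (coeff P i) a b ⟩
    a ℤ.* coeff P i ℤ.+ b ℤ.* coeff P i          ≡⟨ cong₂ ℤ._+_ (coeff-scale a P i) (coeff-scale b P i) ⟨
    coeff (scale a P) i ℤ.+ coeff (scale b P) i  ≡⟨ coeff-+ₚ (scale a P) (scale b P) i ⟨
    coeff (scale a P +ₚ scale b P) i             ∎)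

  *-scale : ∀ a b P → PolyEq q (scale (a ℤ.* b) P) (scale a (scale b P))
  *-scale a b P = polyEq λ i → ≡⇒ModEq (let open ≡.≡-Reasoning in begin
    coeff (scale (a ℤ.* b) P) i      ≡⟨ coeff-scale (a ℤ.* b) P i ⟩
    a ℤ.* b ℤ.* coeff P i            ≡⟨ ℤₚ.*-assoc a b _ ⟩
    a ℤ.* (b ℤ.* coeff P i)          ≡⟨ cong (a ℤ.*_) (coeff-scale b P i) ⟨
    a ℤ.* coeff (scale b P) i        ≡⟨ coeff-scale a (scale b P) i ⟨
    coeff (scale a (scale b P)) i    ∎)

  polySetoid : Setoid 0ℓ 0ℓ
  polySetoid = record { Carrier = Poly ; _≈_ = PolyEq q
    ; isEquivalence = record { refl = polyRefl ; sym = polySym ; trans = polyTrans } }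
  private module PR = SetoidReasoning polySetoid
  open PR

  +ₚ-interchange : ∀ P Q R S → PolyEq q ((P +ₚ Q) +ₚ (R +ₚ S)) ((P +ₚ R) +ₚ (Q +ₚ S))
  +ₚ-interchange P Q R S = begin
    (P +ₚ Q) +ₚ (R +ₚ S)   ≈⟨ +ₚ-assoc P Q _ ⟩
    P +ₚ (Q +ₚ (R +ₚ S))   ≈⟨ +ₚ-cong (polyRefl {P}) (+ₚ-assoc Q R S) ⟨
    P +ₚ ((Q +ₚ R) +ₚ S)   ≈⟨ +ₚ-cong (polyRefl {P}) (+ₚ-cong (+ₚ-comm Q R) polyRefl) ⟩
    P +ₚ ((R +ₚ Q) +ₚ S)   ≈⟨ +ₚ-cong (polyRefl {P}) (+ₚ-assoc R Q S) ⟩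
    P +ₚ (R +ₚ (Q +ₚ S))   ≈⟨ +ₚ-assoc P R _ ⟨
    (P +ₚ R) +ₚ (Q +ₚ S)   ∎

  scale-1 : ∀ P → PolyEq q (scale (+ 1) P) P
  scale-1 P = polyEq λ i → ≡⇒ModEq (≡.trans (coeff-scale (+ 1) P i) (ℤₚ.*-identityˡ _))

  scale-0 : ∀ {a} P → ModEq q a (+ 0) → PolyEq q (scale a P) []
  scale-0 {a} P e = polyEq λ i → Z.trans (≡⇒ModEq (coeff-scale a P i)) (Z.trans (Z.*-congʳ e) (Z.zeroˡ (coeff P i)))

  scale-xmul : ∀ a P → PolyEq q (scale a (xmul P)) (xmul (scale a P))
  scale-xmul a P = ∷-cong (Z.zeroʳ a) polyRefl

  *ₚ-congˡ : ∀ P {Q R} → PolyEq q Q R → PolyEq q (P *ₚ Q) (P *ₚ R)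
  *ₚ-congˡ []      e = polyRefl
  *ₚ-congˡ (a ∷ P) e = +ₚ-cong (scale-cong (Z.refl {a}) e) (∷-cong Z.refl (*ₚ-congˡ P e))

  *ₚ-zeroˡ : ∀ P {Q} → PolyEq q P [] → PolyEq q (P *ₚ Q) []
  *ₚ-zeroˡ []          e = polyRefl
  *ₚ-zeroˡ (a ∷ P) {Q} e = begin
    scale a Q +ₚ xmul (P *ₚ Q)  ≈⟨ +ₚ-cong (scale-0 Q (at e 0)) (0∷≈[] (*ₚ-zeroˡ P (tail≈0 e))) ⟩
    []                          ∎

  *ₚ-zeroʳ : ∀ P → PolyEq q (P *ₚ []) []
  *ₚ-zeroʳ []      = polyRefl
  *ₚ-zeroʳ (a ∷ P) = 0∷≈[] (*ₚ-zeroʳ P)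

  *ₚ-congʳ : ∀ P Q {R} → PolyEq q P Q → PolyEq q (P *ₚ R) (Q *ₚ R)
  *ₚ-congʳ []      Q e = polySym (*ₚ-zeroˡ Q (polySym e))
  *ₚ-congʳ (a ∷ P) [] e = *ₚ-zeroˡ (a ∷ P) e
  *ₚ-congʳ (a ∷ P) (b ∷ Q) e = +ₚ-cong (scale-cong (at e 0) polyRefl) (∷-cong Z.refl (*ₚ-congʳ P Q (tail-cong e)))

  *ₚ-distribʳ : ∀ R P Q → PolyEq q ((P +ₚ Q) *ₚ R) ((P *ₚ R) +ₚ (Q *ₚ R))
  *ₚ-distribʳ R []      Q       = polyRefl
  *ₚ-distribʳ R (a ∷ P) []      = polySym (+ₚ-identityʳ _)
  *ₚ-distribʳ R (a ∷ P) (b ∷ Q) = begin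
    scale (a ℤ.+ b) R +ₚ xmul ((P +ₚ Q) *ₚ R)
      ≈⟨ +ₚ-cong (+-scale a b R) (∷-cong Z.refl (*ₚ-distribʳ R P Q)) ⟩
    (scale a R +ₚ scale b R) +ₚ (xmul (P *ₚ R) +ₚ xmul (Q *ₚ R))
      ≈⟨ +ₚ-interchange (scale a R) (scale b R) (xmul (P *ₚ R)) (xmul (Q *ₚ R)) ⟩
    ((a ∷ P) *ₚ R) +ₚ ((b ∷ Q) *ₚ R) ∎

  -- The mirror image of the defining recursion, peeling the second factor; commutativity follows
  -- from it by induction.
  *ₚ-∷ : ∀ P b Q → PolyEq q (P *ₚ (b ∷ Q)) (scale b P +ₚ xmul (P *ₚ Q))
  *ₚ-∷ []      b Q = polySym (0∷≈[] polyRefl)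
  *ₚ-∷ (a ∷ P) b Q = ∷-cong (Z.+-congʳ (Z.*-comm a b)) (begin
    scale a Q +ₚ (P *ₚ (b ∷ Q))              ≈⟨ +ₚ-cong (polyRefl {scale a Q}) (*ₚ-∷ P b Q) ⟩
    scale a Q +ₚ (scale b P +ₚ xmul (P *ₚ Q)) ≈⟨ +ₚ-assoc (scale a Q) (scale b P) _ ⟨
    (scale a Q +ₚ scale b P) +ₚ xmul (P *ₚ Q) ≈⟨ +ₚ-cong (+ₚ-comm (scale a Q) (scale b P)) polyRefl ⟩
    (scale b P +ₚ scale a Q) +ₚ xmul (P *ₚ Q) ≈⟨ +ₚ-assoc (scale b P) (scale a Q) _ ⟩
    scale b P +ₚ ((a ∷ P) *ₚ Q)               ∎)

  *ₚ-comm : ∀ P Q → PolyEq q (P *ₚ Q) (Q *ₚ P)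
  *ₚ-comm []      Q = polySym (*ₚ-zeroʳ Q)
  *ₚ-comm (a ∷ P) Q = begin
    scale a Q +ₚ xmul (P *ₚ Q)  ≈⟨ +ₚ-cong (polyRefl {scale a Q}) (∷-cong Z.refl (*ₚ-comm P Q)) ⟩
    scale a Q +ₚ xmul (Q *ₚ P)  ≈⟨ *ₚ-∷ Q a P ⟨
    Q *ₚ (a ∷ P)                ∎

  scale-*ₚ : ∀ a P Q → PolyEq q (scale a P *ₚ Q) (scale a (P *ₚ Q))
  scale-*ₚ a []      Q = polyRefl
  scale-*ₚ a (b ∷ P) Q = begin
    scale (a ℤ.* b) Q +ₚ xmul (scale a P *ₚ Q)
      ≈⟨ +ₚ-cong (*-scale a b Q) (∷-cong Z.refl (scale-*ₚ a P Q)) ⟩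
    scale a (scale b Q) +ₚ xmul (scale a (P *ₚ Q))
      ≈⟨ +ₚ-cong (polyRefl {scale a (scale b Q)}) (scale-xmul a (P *ₚ Q)) ⟨
    scale a (scale b Q) +ₚ scale a (xmul (P *ₚ Q))
      ≈⟨ scale-+ₚ a (scale b Q) (xmul (P *ₚ Q)) ⟨
    scale a ((b ∷ P) *ₚ Q) ∎

  xmul-*ₚ : ∀ P Q → PolyEq q (xmul P *ₚ Q) (xmul (P *ₚ Q))
  xmul-*ₚ P Q = +ₚ-cong (scale-0 Q Z.refl) (polyRefl {xmul (P *ₚ Q)})

  *ₚ-assoc : ∀ P Q R → PolyEq q ((P *ₚ Q) *ₚ R) (P *ₚ (Q *ₚ R))
  *ₚ-assoc []      Q R = polyRefl
  *ₚ-assoc (a ∷ P) Q R = begin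
    (scale a Q +ₚ xmul (P *ₚ Q)) *ₚ R            ≈⟨ *ₚ-distribʳ R (scale a Q) (xmul (P *ₚ Q)) ⟩
    (scale a Q *ₚ R) +ₚ (xmul (P *ₚ Q) *ₚ R)     ≈⟨ +ₚ-cong (scale-*ₚ a Q R) (xmul-*ₚ (P *ₚ Q) R) ⟩
    scale a (Q *ₚ R) +ₚ xmul ((P *ₚ Q) *ₚ R)     ≈⟨ +ₚ-cong (polyRefl {scale a (Q *ₚ R)}) (∷-cong Z.refl (*ₚ-assoc P Q R)) ⟩
    (a ∷ P) *ₚ (Q *ₚ R)                          ∎

  *ₚ-identityˡ : ∀ P → PolyEq q (oneₚ *ₚ P) P
  *ₚ-identityˡ P = begin
    scale (+ 1) P +ₚ xmul []  ≈⟨ +ₚ-cong (scale-1 P) (0∷≈[] polyRefl) ⟩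
    P +ₚ []                   ≈⟨ +ₚ-identityʳ P ⟩
    P                         ∎

polyRing : ℕ → CommutativeRing 0ℓ 0ℓ
polyRing q = record
  { Carrier = Poly ; _≈_ = PolyEq q ; _+_ = _+ₚ_ ; _*_ = _*ₚ_ ; -_ = -ₚ_ ; 0# = [] ; 1# = oneₚ
  ; isCommutativeRing = record
    { isRing = record
      { +-isAbelianGroup = record
        { isGroup = record
          { isMonoid = record
            { isSemigroup = record
              { isMagma = record
                { isEquivalence = record { refl = polyRefl ; sym = polySym ; trans = polyTrans }
                ; ∙-cong = +ₚ-cong }
              ; assoc = +ₚ-assoc }
            ; identity = (λ P → polyRefl) , +ₚ-identityʳ }
          ; inverse = (λ P → polyTrans (+ₚ-comm (-ₚ P) P) (-ₚ-inverseʳ P)) , -ₚ-inverseʳ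
          ; ⁻¹-cong = -ₚ-cong }
        ; comm = +ₚ-comm }
      ; *-cong = λ {P} {P′} {Q} {Q′} e f → polyTrans (*ₚ-congʳ P P′ e) (*ₚ-congˡ P′ f)
      ; *-assoc = *ₚ-assoc
      ; *-identity = *ₚ-identityˡ , (λ P → polyTrans (*ₚ-comm P oneₚ) (*ₚ-identityˡ P))
      ; distrib = (λ P Q R → polyTrans (*ₚ-comm P (Q +ₚ R))
                    (polyTrans (*ₚ-distribʳ P Q R) (+ₚ-cong (*ₚ-comm Q P) (*ₚ-comm R P))))
                , *ₚ-distribʳ }
    ; *-comm = *ₚ-comm } }

-- A partial test for the ring solver. It recognises lists of literal zeros, so that coefficients
-- which cancel by computation disappear from normal forms.
isZero? : ∀ P → Maybe (PolyEq 0 [] P)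
isZero? []        = just polyRefl
isZero? (+ 0 ∷ P) with isZero? P
... | just e  = just (polySym (0∷≈[] (polySym e)))
... | nothing = nothing
isZero? (_ ∷ P)   = nothing

ℤ[x] : AlmostCommutativeRing 0ℓ 0ℓ
ℤ[x] = fromCommutativeRing (polyRing 0) isZero?

infix 4 _≋_
_≋_ : Poly → Poly → Set
_≋_ = PolyEq 0

≋⇒≈ₚ : ∀ {P Q} → P ≋ Q → P ≈ₚ Q
≋⇒≈ₚ e i = ModEq-0 (at e i)

reduce : ∀ {q P Q} → P ≋ Q → PolyEq q P Q
reduce e = ≈ₚ⇒PolyEq (≋⇒≈ₚ e)

module ≋ = CommutativeRing (polyRing 0)
module ≋-Reasoning = SetoidReasoning ≋.setoid

-- Divisibility in ℤ[x]

infix 4 _∣ₓ_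
-- `_∣ₚ_` unfolds to a statement about coefficients from which `Q` and `P` cannot be inferred; the
-- record keeps them visible to unification.
record _∣ₓ_ (Q P : Poly) : Set where
  constructor dividesₓ
  field
    quotientₓ : Poly
    equalityₓ : P ≋ Q *ₚ quotientₓ

∣ₓ⇒∣ₚ : ∀ {P Q} → Q ∣ₓ P → Q ∣ₚ P
∣ₓ⇒∣ₚ (dividesₓ A e) = A , ≋⇒≈ₚ e

∣ₚ⇒∣ₓ : ∀ {P Q} → Q ∣ₚ P → Q ∣ₓ P
∣ₚ⇒∣ₓ (A , e) = dividesₓ A (≈ₚ⇒PolyEq e)

∣ₓ-refl : ∀ {P} → P ∣ₓ P
∣ₓ-refl {P} = dividesₓ oneₚ (≋.sym (≋.*-identityʳ P))

∣ₓ-trans : ∀ {P Q R} → P ∣ₓ Q → Q ∣ₓ R → P ∣ₓ R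
∣ₓ-trans {P} {Q} {R} (dividesₓ A e) (dividesₓ B f) = dividesₓ (A *ₚ B)
  (≋.trans f (≋.trans (≋.*-congʳ e) (≋.*-assoc P A B)))

∣ₓ-respʳ : ∀ {P Q R} → Q ≋ R → P ∣ₓ Q → P ∣ₓ R
∣ₓ-respʳ e (dividesₓ A f) = dividesₓ A (≋.trans (≋.sym e) f)

∣ₓ-respˡ : ∀ {P Q R} → P ≋ Q → P ∣ₓ R → Q ∣ₓ R
∣ₓ-respˡ e (dividesₓ A f) = dividesₓ A (≋.trans f (≋.*-congʳ e))

∣ₓ-m*n : ∀ {P A} B → P ∣ₓ A → P ∣ₓ A *ₚ B
∣ₓ-m*n {P} B (dividesₓ Q e) = dividesₓ (Q *ₚ B) (≋.trans (≋.*-congʳ e) (≋.*-assoc P Q B))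

∣ₓ-n*m : ∀ {P A} B → P ∣ₓ A → P ∣ₓ B *ₚ A
∣ₓ-n*m {P} {A} B d = ∣ₓ-respʳ (≋.*-comm A B) (∣ₓ-m*n B d)

∣ₓ-+ : ∀ {P A B} → P ∣ₓ A → P ∣ₓ B → P ∣ₓ A +ₚ B
∣ₓ-+ {P} (dividesₓ Q e) (dividesₓ R f) =
  dividesₓ (Q +ₚ R) (≋.trans (≋.+-cong e f) (≋.sym (≋.distribˡ P Q R)))

∣ₓ-neg : ∀ {P A} → P ∣ₓ A → P ∣ₓ (-ₚ A)
∣ₓ-neg {P} {A} (dividesₓ Q e) = dividesₓ (-ₚ Q) (≋.trans (≋.-‿cong e) (lem P Q))
  where lem : ∀ P Q → -ₚ (P *ₚ Q) ≋ P *ₚ (-ₚ Q)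
        lem = solve-∀ ℤ[x]

∣ₓ-+-cancelˡ : ∀ {P A} B → P ∣ₓ A +ₚ B → P ∣ₓ A → P ∣ₓ B
∣ₓ-+-cancelˡ {P} {A} B d e = ∣ₓ-respʳ (lem A B) (∣ₓ-+ d (∣ₓ-neg e))
  where lem : ∀ A B → (A +ₚ B) +ₚ (-ₚ A) ≋ B
        lem = solve-∀ ℤ[x]

-- Integral domains ℤ/q

-- Satisfied by primes and by 0, so that cancellation in `𝔽_p[x]` and in `ℤ[x]` is a single proof.
NoZeroDivisors : ℕ → Set
NoZeroDivisors q = ∀ a b → ModEq q (a ℤ.* b) (+ 0) → ModEq q a (+ 0) ⊎ ModEq q b (+ 0)

∣⇒ModEq0 : ∀ {q a} → + q ∣ a → ModEq q a (+ 0)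
∣⇒ModEq0 {q} {a} d = modEq (subst (+ q ∣_) (≡.sym (ℤₚ.+-identityʳ a)) d)

ModEq0⇒∣ : ∀ {q a} → ModEq q a (+ 0) → + q ∣ a
ModEq0⇒∣ {q} {a} (modEq d) = subst (+ q ∣_) (ℤₚ.+-identityʳ a) d

prime⇒noZeroDivisors : ∀ {p} → Prime p → NoZeroDivisors p
prime⇒noZeroDivisors {p} pr a b e =
  Sum.map (∣⇒ModEq0 ∘ ∣ᵤ⇒∣) (∣⇒ModEq0 ∘ ∣ᵤ⇒∣)
    (euclidsLemma ∣ a ∣ ∣ b ∣ pr (subst (p ℕᵈ.∣_) (ℤₚ.abs-* a b) (∣⇒∣ᵤ (ModEq0⇒∣ e))))

0-noZeroDivisors : NoZeroDivisors 0
0-noZeroDivisors a b e = Sum.map ≡⇒ModEq ≡⇒ModEq (ℤₚ.i*j≡0⇒i≡0∨j≡0 a (ModEq-0 e))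

module _ {q : ℕ} where
  private
    module Z = CommutativeRing (ℤmod q)
    module P = CommutativeRing (polyRing q)
    ∷-cong≈[] : ∀ {a A} → ModEq q a (+ 0) → PolyEq q A [] → PolyEq q (a ∷ A) []
    ∷-cong≈[] e f = P.trans (∷-cong e f) (0∷≈[] polyRefl)
  open SetoidReasoning P.setoid

  -- The constant term of the product is `a b`, so `a` or `b` vanishes, and dividing that factor by
  -- x shortens its list. Working from the low end avoids leading coefficients, which trailing zeros
  -- hide.
  *ₚ≈0 : NoZeroDivisors q → ∀ A B → PolyEq q (A *ₚ B) [] → PolyEq q A [] ⊎ PolyEq q B []
  *ₚ≈0 nzd []      B       e = inj₁ polyRefl
  *ₚ≈0 nzd (a ∷ A) []      e = inj₂ polyRefl
  *ₚ≈0 nzd (a ∷ A) (b ∷ B) e = [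
    (λ a≈0 → Sum.map₁ (∷-cong≈[] a≈0) (*ₚ≈0 nzd A (b ∷ B) (tail≈0 {a = + 0} (begin
      xmul (A *ₚ (b ∷ B))   ≈⟨ xmul-*ₚ A (b ∷ B) ⟨
      xmul A *ₚ (b ∷ B)     ≈⟨ *ₚ-congʳ (xmul A) (a ∷ A) {b ∷ B} (∷-cong (Z.sym a≈0) polyRefl) ⟩
      (a ∷ A) *ₚ (b ∷ B)    ≈⟨ e ⟩
      []                    ∎)))) ,
    (λ b≈0 → Sum.map₂ (∷-cong≈[] b≈0) (*ₚ≈0 nzd (a ∷ A) B (tail≈0 {a = + 0} (begin
      xmul ((a ∷ A) *ₚ B)   ≈⟨ ∷-cong Z.refl (*ₚ-comm (a ∷ A) B) ⟩
      xmul (B *ₚ (a ∷ A))   ≈⟨ xmul-*ₚ B (a ∷ A) ⟨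
      xmul B *ₚ (a ∷ A)     ≈⟨ *ₚ-comm (xmul B) (a ∷ A) ⟩
      (a ∷ A) *ₚ xmul B     ≈⟨ *ₚ-congˡ (a ∷ A) (∷-cong (Z.sym b≈0) polyRefl) ⟩
      (a ∷ A) *ₚ (b ∷ B)    ≈⟨ e ⟩
      []                    ∎)))) ]′
    (nzd a b (Z.trans (Z.sym (Z.+-identityʳ _)) (at e 0)))

  *ₚ-cancelˡ : NoZeroDivisors q → ∀ A {B C} → ¬ PolyEq q A [] → PolyEq q (A *ₚ B) (A *ₚ C) → PolyEq q B C
  *ₚ-cancelˡ nzd A {B} {C} A≉0 e = case *ₚ≈0 nzd A (B +ₚ (-ₚ C)) step of λ where
      (inj₁ A≈0)   → contradiction A≈0 A≉0
      (inj₂ B-C≈0) → P.trans (reduce (lem₂ B C)) (P.+-congʳ {C} B-C≈0)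
    where
    lem₁ : ∀ A B C → A *ₚ (B +ₚ (-ₚ C)) ≋ (A *ₚ B) +ₚ (-ₚ (A *ₚ C))
    lem₁ = solve-∀ ℤ[x]
    lem₂ : ∀ B C → B ≋ (B +ₚ (-ₚ C)) +ₚ C
    lem₂ = solve-∀ ℤ[x]
    step : PolyEq q (A *ₚ (B +ₚ (-ₚ C))) []
    step = P.trans (reduce (lem₁ A B C)) (P.trans (P.+-congʳ {(-ₚ (A *ₚ C))} e) (P.-‿inverseʳ (A *ₚ C)))

-- Constants and Gauss's lemma

const : ℤ → Poly
const a = a ∷ []

const-*ₚ : ∀ a P → const a *ₚ P ≋ scale a P
const-*ₚ a P = ≋.trans (≋.+-congˡ {scale a P} (0∷≈[] polyRefl)) (≋.+-identityʳ _)

coeff-const-*ₚ : ∀ a P i → coeff (const a *ₚ P) i ≡ a ℤ.* coeff P i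
coeff-const-*ₚ a P i = ≡.trans (≋⇒≈ₚ (const-*ₚ a P) i) (coeff-scale a P i)

const-* : ∀ a b → const (a ℤ.* b) ≋ const a *ₚ const b
const-* a b = ≋.sym (const-*ₚ a (const b))

const≋0 : ∀ {a} → const a ≋ [] → a ≡ + 0
const≋0 e = ModEq-0 (at e 0)

const-cong : ∀ {a b} → a ≡ b → const a ≋ const b
const-cong refl = ≋.refl

-- Turns a conclusion reached in `𝔽_p[x]` back into a division in `ℤ[x]`.
≈0⇒const∣ : ∀ q P → PolyEq q P [] → const (+ q) ∣ₓ P
≈0⇒const∣ q []      e = dividesₓ [] (≋.sym (≋.zeroʳ (const (+ q))))
≈0⇒const∣ q (a ∷ P) e with ModEq0⇒∣ (at e 0) | ≈0⇒const∣ q P (tail≈0 e)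
... | divides k a≡kq | dividesₓ Q P≋qQ = dividesₓ (k ∷ Q)
  (≋.trans (∷-cong (≡⇒ModEq (≡.trans a≡kq (ℤₚ.*-comm k (+ q)))) (≋.trans P≋qQ (const-*ₚ (+ q) Q)))
    (≋.sym (const-*ₚ (+ q) (k ∷ Q))))

const∣⇒≈0 : ∀ q A → PolyEq q (const (+ q) *ₚ A) []
const∣⇒≈0 q A = polyEq λ i → ∣⇒ModEq0 (subst (+ q ∣_) (≡.sym (coeff-const-*ₚ (+ q) A i))
  (∣m⇒∣m*n (coeff A i) (divides (+ 1) (≡.sym (ℤₚ.*-identityˡ (+ q))))))

-- Gauss's lemma without contents: a factorisation `D S` of a constant multiple of `A` becomes one
-- of `A` itself once the constant is distributed over the two factors.
record GaussSplit (A D S : Poly) : Set where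
  field
    D₀ S₀  : Poly
    d s    : ℤ
    A≋D₀S₀ : A ≋ D₀ *ₚ S₀
    D≋dD₀  : D ≋ const d *ₚ D₀
    S≋sS₀  : S ≋ const s *ₚ S₀

const≉0 : ∀ {a} → a ≢ + 0 → ¬ const a ≋ []
const≉0 a≢0 e = a≢0 (const≋0 e)

-- One prime of the constant at a time: `D S` vanishes modulo `p`, hence so does `D` or `S`, and `p`
-- is cancelled there and recorded in `d` or `s`.
gaussSplit-product : ∀ ps → All Prime ps → ∀ A D S →
  const (+ product ps) *ₚ A ≋ D *ₚ S → GaussSplit A D S
gaussSplit-product [] [] A D S e = record
  { D₀ = D ; S₀ = S ; d = + 1 ; s = + 1 ; A≋D₀S₀ = ≋.trans (≋.sym (≋.*-identityˡ A)) e
  ; D≋dD₀ = ≋.sym (≋.*-identityˡ D) ; S≋sS₀ = ≋.sym (≋.*-identityˡ S) }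
gaussSplit-product (p ∷ ps) (pr ∷ prs) A D S e =
  case *ₚ≈0 (prime⇒noZeroDivisors pr) D S
         (polyTrans (reduce (≋.trans (≋.sym e) pull)) (const∣⇒≈0 p (const (+ r) *ₚ A))) of λ where
    (inj₁ D≈0) → case ≈0⇒const∣ p D D≈0 of λ where
      (dividesₓ D′ D≋pD′) →
        let open GaussSplit (gaussSplit-product ps prs A D′ S
              (cancelP (≋.trans (≋.sym pull) (≋.trans e (≋.trans (≋.*-congʳ D≋pD′) (≋.*-assoc (const (+ p)) D′ S)))))) in
        record { D₀ = D₀ ; S₀ = S₀ ; d = + p ℤ.* d ; s = s ; A≋D₀S₀ = A≋D₀S₀
               ; D≋dD₀ = absorb D≋pD′ D≋dD₀ ; S≋sS₀ = S≋sS₀ }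
    (inj₂ S≈0) → case ≈0⇒const∣ p S S≈0 of λ where
      (dividesₓ S′ S≋pS′) →
        let open GaussSplit (gaussSplit-product ps prs A D S′
              (cancelP (≋.trans (≋.sym pull) (≋.trans e (≋.trans (≋.*-congˡ {D} S≋pS′) (swap D (const (+ p)) S′)))))) in
        record { D₀ = D₀ ; S₀ = S₀ ; d = d ; s = + p ℤ.* s ; A≋D₀S₀ = A≋D₀S₀
               ; D≋dD₀ = D≋dD₀ ; S≋sS₀ = absorb S≋pS′ S≋sS₀ }
  where
  r = product ps
  pull : const (+ (p ℕ.* r)) *ₚ A ≋ const (+ p) *ₚ (const (+ r) *ₚ A)
  pull = ≋.trans (≋.*-congʳ (≋.trans (const-cong (ℤₚ.pos-* p r)) (const-* (+ p) (+ r))))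
                 (≋.*-assoc (const (+ p)) (const (+ r)) A)
  cancelP : ∀ {B C} → const (+ p) *ₚ B ≋ const (+ p) *ₚ C → B ≋ C
  cancelP = *ₚ-cancelˡ 0-noZeroDivisors (const (+ p))
    (const≉0 λ p≡0 → ℕ.≢-nonZero⁻¹ p {{prime⇒nonZero pr}} (ℤₚ.+-injective p≡0))
  absorb : ∀ {B C C₀ c} → B ≋ const (+ p) *ₚ C → C ≋ const c *ₚ C₀ → B ≋ const (+ p ℤ.* c) *ₚ C₀
  absorb {B} {C} {C₀} {c} e f = ≋.trans e (≋.trans (≋.*-congˡ {const (+ p)} f)
    (≋.trans (≋.sym (≋.*-assoc (const (+ p)) (const c) C₀)) (≋.*-congʳ (≋.sym (const-* (+ p) c)))))
  swap : ∀ D P S → D *ₚ (P *ₚ S) ≋ P *ₚ (D *ₚ S)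
  swap = solve-∀ ℤ[x]

gaussSplit : ∀ c → c ≢ + 0 → ∀ {A D S} → const c *ₚ A ≋ D *ₚ S → GaussSplit A D S
gaussSplit (+ zero)  c≢0 e = contradiction refl c≢0
gaussSplit (+ suc n) c≢0 {A} {D} {S} e =
  gaussSplit-product factors factorsPrime A D S
    (≋.trans (≋.*-congʳ {A} (const-cong (cong +_ (≡.sym isFactorisation)))) e)
  where open PrimeFactorisation (factorise (suc n))
gaussSplit -[1+ n ]  c≢0 {A} {D} {S} e = record
  { D₀ = D₀ ; S₀ = S₀ ; d = d ; s = ℤ.- s ; A≋D₀S₀ = A≋D₀S₀ ; D≋dD₀ = D≋dD₀
  ; S≋sS₀ = ≋.trans (lem₂ S) (≋.trans (≋.-‿cong S≋sS₀) (lem₃ (const s) S₀)) }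
  where
  lem₁ : ∀ c A → (-ₚ c) *ₚ A ≋ -ₚ (c *ₚ A)
  lem₁ = solve-∀ ℤ[x]
  lem₂ : ∀ S → S ≋ -ₚ (-ₚ S)
  lem₂ = solve-∀ ℤ[x]
  lem₃ : ∀ s S → -ₚ (s *ₚ S) ≋ (-ₚ s) *ₚ S
  lem₃ = solve-∀ ℤ[x]
  lem₄ : ∀ D S → -ₚ (D *ₚ S) ≋ D *ₚ (-ₚ S)
  lem₄ = solve-∀ ℤ[x]
  open GaussSplit (gaussSplit (+ suc n) (λ ()) {A} {D} { -ₚ S}
    (≋.trans (lem₁ (const -[1+ n ]) A) (≋.trans (≋.-‿cong e) (lem₄ D S))))

-- Degrees and division

DegLt : ℕ → Poly → Set
DegLt n P = ∀ i → n ≤ i → coeff P i ≡ + 0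

DegLt-cong : ∀ {n P Q} → P ≋ Q → DegLt n P → DegLt n Q
DegLt-cong e h i n≤i = ≡.trans (≡.sym (≋⇒≈ₚ e i)) (h i n≤i)

DegLt-0 : ∀ {P} → DegLt 0 P → P ≋ []
DegLt-0 h = ≈ₚ⇒PolyEq λ i → h i z≤n

HasDegree : ℕ → Poly → Set
HasDegree d P = coeff P d ≢ + 0 × DegLt (suc d) P

degree? : ∀ P → P ≋ [] ⊎ ∃ λ d → HasDegree d P
degree? []      = inj₁ ≋.refl
degree? (a ∷ P) with degree? P | a ℤ.≟ + 0
... | inj₂ (d , c≢0 , h) | _       = inj₂ (suc d , c≢0 , λ { (suc i) (s≤s l) → h i l })
... | inj₁ P≋0           | no a≢0  = inj₂ (0 , a≢0 , λ { (suc i) _ → ≋⇒≈ₚ P≋0 i })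
... | inj₁ P≋0           | yes a≡0 = inj₁ (≋.trans (∷-cong (≡⇒ModEq a≡0) P≋0) (0∷≈[] polyRefl))

_≋0? : ∀ P → Dec (P ≋ [])
P ≋0? with degree? P
... | inj₁ P≋0           = yes P≋0
... | inj₂ (d , c≢0 , _) = no λ P≋0 → c≢0 (≋⇒≈ₚ P≋0 d)

-- Declarations are abstract where unfolding them under `with` is intractable.
abstract
  _≋?_ : ∀ P Q → Dec (P ≋ Q)
  P ≋? Q = map′ (λ e → ≋.trans (lem P Q) (≋.+-congʳ {Q} e)) (λ e → ≋.trans (≋.+-congʳ {(-ₚ Q)} e) (≋.-‿inverseʳ Q))
                ((P +ₚ (-ₚ Q)) ≋0?)
    where lem : ∀ P Q → P ≋ (P +ₚ (-ₚ Q)) +ₚ Q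
          lem = solve-∀ ℤ[x]

degree-unique : ∀ {P d e} → HasDegree d P → HasDegree e P → d ≡ e
degree-unique {P} (c , h) (c′ , h′) = ℕₚ.≤-antisym (bound c h′) (bound c′ h)
  where
  bound : ∀ {d e} → coeff P d ≢ + 0 → DegLt (suc e) P → d ≤ e
  bound c h = ℕₚ.≮⇒≥ λ e<d → c (h _ e<d)

coeff-∷-*ₚ : ∀ a P Q i → coeff ((a ∷ P) *ₚ Q) i ≡ a ℤ.* coeff Q i ℤ.+ coeff (xmul (P *ₚ Q)) i
coeff-∷-*ₚ a P Q i = ≡.trans (coeff-+ₚ (scale a Q) (xmul (P *ₚ Q)) i)
  (cong (ℤ._+ coeff (xmul (P *ₚ Q)) i) (coeff-scale a Q i))

*ₚ-top : ∀ P Q {a b} → DegLt (suc a) P → DegLt (suc b) Q →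
  coeff (P *ₚ Q) (a ℕ.+ b) ≡ coeff P a ℤ.* coeff Q b × DegLt (suc (a ℕ.+ b)) (P *ₚ Q)
*ₚ-top []      Q h k = refl , λ i _ → refl
*ₚ-top (c ∷ P) Q {zero} {b} h k = low b , λ i l → ≡.trans (low i) (≡.trans (cong (c ℤ.*_) (k i l)) (ℤₚ.*-zeroʳ c))
  where
  low : ∀ i → coeff ((c ∷ P) *ₚ Q) i ≡ c ℤ.* coeff Q i
  low i = ≡.trans (coeff-∷-*ₚ c P Q i) (≡.trans
    (cong (λ t → c ℤ.* coeff Q i ℤ.+ t) (≋⇒≈ₚ (0∷≈[] (*ₚ-zeroˡ P (DegLt-0 λ j _ → h (suc j) (s≤s z≤n)))) i))
    (ℤₚ.+-identityʳ _))
*ₚ-top (c ∷ P) Q {suc a} {b} h k with *ₚ-top P Q {a} {b} (λ i l → h (suc i) (s≤s l)) k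
... | top , above = ≡.trans (high (a ℕ.+ b) (s≤s (ℕₚ.m≤n+m b a))) top
                  , λ { (suc i) (s≤s l) → ≡.trans (high i (ℕₚ.≤-trans (s≤s (ℕₚ.m≤n+m b a)) (ℕₚ.m≤n⇒m≤1+n l))) (above i l) }
  where
  high : ∀ i → suc b ≤ suc i → coeff ((c ∷ P) *ₚ Q) (suc i) ≡ coeff (P *ₚ Q) i
  high i l = ≡.trans (coeff-∷-*ₚ c P Q (suc i)) (≡.trans
    (cong (ℤ._+ coeff (P *ₚ Q) i) (≡.trans (cong (c ℤ.*_) (k (suc i) l)) (ℤₚ.*-zeroʳ c)))
    (ℤₚ.+-identityˡ _))

*-≢0 : ∀ {a b} → a ≢ + 0 → b ≢ + 0 → a ℤ.* b ≢ + 0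
*-≢0 {a} a≢0 b≢0 e = [ a≢0 , b≢0 ]′ (ℤₚ.i*j≡0⇒i≡0∨j≡0 a e)

*ₚ-degree : ∀ {P Q a b} → HasDegree a P → HasDegree b Q → HasDegree (a ℕ.+ b) (P *ₚ Q)
*ₚ-degree {P} {Q} (c , h) (c′ , k) with *ₚ-top P Q h k
... | top , above = (λ e → *-≢0 c c′ (≡.trans (≡.sym top) e)) , above

X : Poly
X = xmul oneₚ

xmul≋X*ₚ : ∀ P → xmul P ≋ X *ₚ P
xmul≋X*ₚ P = ≋.sym (≋.trans (xmul-*ₚ oneₚ P) (∷-cong (≡⇒ModEq refl) (≋.*-identityˡ P)))

-- Division by a divisor that need not be monic: a power of its leading coefficient `b` clears the
-- denominators. For `b = 1` this is ordinary division with remainder.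
record PseudoDivision (d : ℕ) (b : ℤ) (A B : Poly) : Set where
  field
    t         : ℕ
    E R       : Poly
    equation  : const (b ℤ.^ t) *ₚ A ≋ B *ₚ E +ₚ R
    remainder : DegLt d R

pseudoDivision : ∀ {d} B → DegLt (suc d) B → ∀ A → PseudoDivision d (coeff B d) A B
pseudoDivision {d} B h [] = record
  { t = 0 ; E = [] ; R = []
  ; equation = ≋.trans (≋.zeroʳ oneₚ) (≋.sym (≋.trans (≋.+-congʳ {[]} (≋.zeroʳ B)) ≋.refl)) ; remainder = λ i _ → refl }
pseudoDivision {d} B h (a ∷ A) = record
  -- Dividing `A` leaves `N = c a + x R` of degree at most `d` as remainder of `c (a + x A)`; then
  -- `b N - r B`, with `r` the coefficient of `N` at `d`, loses that top term.
  { t = suc t ; E = const b *ₚ xmul E +ₚ const r ; R = const b *ₚ N +ₚ (-ₚ (const r *ₚ B))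
  ; equation = begin
      const (b ℤ.* c) *ₚ (a ∷ A)
        ≈⟨ ≋.*-cong (const-* b c) (split a A) ⟩
      const b *ₚ const c *ₚ (const a +ₚ X *ₚ A)
        ≈⟨ lem₁ (const a) X (const b) (const c) A ⟩
      const b *ₚ (const c *ₚ const a +ₚ X *ₚ (const c *ₚ A))
        ≈⟨ ≋.*-congˡ {const b} (≋.+-congˡ {const c *ₚ const a} (≋.*-congˡ {X} equation)) ⟩
      const b *ₚ (const c *ₚ const a +ₚ X *ₚ (B *ₚ E +ₚ R))
        ≈⟨ lem₂ (const a) X (const b) (const c) B E R (const r) ⟩
      B *ₚ (const b *ₚ (X *ₚ E) +ₚ const r) +ₚ (const b *ₚ (const c *ₚ const a +ₚ X *ₚ R) +ₚ (-ₚ (const r *ₚ B)))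
        ≈⟨ ≋.+-cong (≋.*-congˡ {B} (≋.+-congʳ {const r} (≋.*-congˡ {const b} (xmul≋X*ₚ E))))
                    (≋.+-congʳ {(-ₚ (const r *ₚ B))} (≋.*-congˡ {const b} N-split)) ⟨
      B *ₚ (const b *ₚ xmul E +ₚ const r) +ₚ (const b *ₚ N +ₚ (-ₚ (const r *ₚ B))) ∎
  ; remainder = λ i l → ≡.trans (value i) (vanish i l) }
  where
  open PseudoDivision (pseudoDivision B h A)
  open ≋-Reasoning
  b = coeff B d
  c = b ℤ.^ t
  N = c ℤ.* a ∷ R
  r = coeff N d
  split : ∀ a P → a ∷ P ≋ const a +ₚ X *ₚ P
  split a P = ≋.trans (∷-cong (≡⇒ModEq (≡.sym (ℤₚ.+-identityʳ a))) ≋.refl) (≋.+-congˡ {const a} (xmul≋X*ₚ P))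
  N-split : N ≋ const c *ₚ const a +ₚ X *ₚ R
  N-split = ≋.trans (split (c ℤ.* a) R) (≋.+-congʳ {X *ₚ R} (const-* c a))
  lem₁ : ∀ a X b c A → b *ₚ c *ₚ (a +ₚ X *ₚ A) ≋ b *ₚ (c *ₚ a +ₚ X *ₚ (c *ₚ A))
  lem₁ = solve-∀ ℤ[x]
  lem₂ : ∀ a X b c B E R r → b *ₚ (c *ₚ a +ₚ X *ₚ (B *ₚ E +ₚ R))
           ≋ B *ₚ (b *ₚ (X *ₚ E) +ₚ r) +ₚ (b *ₚ (c *ₚ a +ₚ X *ₚ R) +ₚ (-ₚ (r *ₚ B)))
  lem₂ = solve-∀ ℤ[x]
  value : ∀ i → coeff (const b *ₚ N +ₚ (-ₚ (const r *ₚ B))) i ≡ b ℤ.* coeff N i ℤ.+ ℤ.- (r ℤ.* coeff B i)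
  value i = ≡.trans (coeff-+ₚ (const b *ₚ N) (-ₚ (const r *ₚ B)) i) (cong₂ ℤ._+_ (coeff-const-*ₚ b N i)
    (≡.trans (coeff--ₚ (const r *ₚ B) i) (cong ℤ.-_ (coeff-const-*ₚ r B i))))
  N-deg : ∀ i → suc d ≤ i → coeff N i ≡ + 0
  N-deg (suc i) (s≤s l) = remainder i l
  comm : ∀ b r → b ℤ.* r ℤ.+ ℤ.- (r ℤ.* b) ≡ + 0
  comm = ℤSolver.solve-∀
  vanish : ∀ i → d ≤ i → b ℤ.* coeff N i ℤ.+ ℤ.- (r ℤ.* coeff B i) ≡ + 0
  vanish i l with ℕₚ.m≤n⇒m<n∨m≡n l
  ... | inj₂ refl = comm b r
  ... | inj₁ d<i  = ≡.trans (cong₂ (λ s t → b ℤ.* s ℤ.+ ℤ.- (r ℤ.* t)) (N-deg i d<i) (h i d<i)) (zeros b r)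
    where zeros : ∀ b r → b ℤ.* + 0 ℤ.+ ℤ.- (r ℤ.* + 0) ≡ + 0
          zeros = ℤSolver.solve-∀

-- Monic polynomials

MonicOfDegree : ℕ → Poly → Set
MonicOfDegree d P = coeff P d ≡ + 1 × DegLt (suc d) P

monic⇒degree : ∀ P (m : Monic P) → HasDegree (proj₁ m) P
monic⇒degree P (d , e , h) = (λ e′ → case ≡.trans (≡.sym e) e′ of λ ()) , h

monic≉0 : ∀ {P} → Monic P → ¬ P ≋ []
monic≉0 {P} m@(d , _) e = proj₁ (monic⇒degree P m) (≋⇒≈ₚ e d)

monic-cong : ∀ {P Q} → P ≋ Q → Monic P → Monic Q
monic-cong e (d , c , h) = d , ≡.trans (≡.sym (≋⇒≈ₚ e d)) c , DegLt-cong e h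

monic-one : Monic oneₚ
monic-one = 0 , refl , λ { (suc i) _ → refl }

monic-* : ∀ {P Q} → Monic P → Monic Q → Monic (P *ₚ Q)
monic-* {P} {Q} (d , c , h) (e , c′ , k) with *ₚ-top P Q h k
... | top , above = d ℕ.+ e , ≡.trans top (cong₂ ℤ._*_ c c′) , above

abstract
  monic-cofactor : ∀ P A B → Monic P → Monic A → P ≋ A *ₚ B → Monic B
  monic-cofactor P A B m@(p , c , _) n@(a , c′ , h) e with degree? B
  ... | inj₁ B≋0 = contradiction (≋.trans e (≋.trans (≋.*-congˡ {A} B≋0) (≋.zeroʳ A))) (monic≉0 {P} m)
  ... | inj₂ (b , k@(_ , k′)) = b , ≡.trans (≡.sym step) c , k′
    where
    p≡a+b : p ≡ a ℕ.+ b
    p≡a+b = degree-unique {A *ₚ B} (monic⇒degree (A *ₚ B) (monic-cong e m)) (*ₚ-degree {A} {B} (monic⇒degree A n) k)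
    step : coeff P p ≡ coeff B b
    step = begin
      coeff P p                  ≡⟨ ≋⇒≈ₚ e p ⟩
      coeff (A *ₚ B) p           ≡⟨ cong (coeff (A *ₚ B)) p≡a+b ⟩
      coeff (A *ₚ B) (a ℕ.+ b)   ≡⟨ proj₁ (*ₚ-top A B h k′) ⟩
      coeff A a ℤ.* coeff B b    ≡⟨ cong (ℤ._* coeff B b) c′ ⟩
      + 1 ℤ.* coeff B b          ≡⟨ ℤₚ.*-identityˡ _ ⟩
      coeff B b                  ∎
      where open ≡.≡-Reasoning

degree-0⇒const : ∀ {P} → DegLt 1 P → P ≋ const (coeff P 0)
degree-0⇒const h = ≈ₚ⇒PolyEq λ { zero → refl ; (suc i) → h (suc i) (s≤s z≤n) }

degree-0⇒one : ∀ {P} → MonicOfDegree 0 P → P ≋ oneₚ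
degree-0⇒one (c , h) = ≋.trans (degree-0⇒const h) (const-cong c)

-- The cofactors are monic too, and comparing degrees twice forces theirs to be 0.
monic-∣-antisym : ∀ {P Q} → Monic P → Monic Q → P ∣ₓ Q → Q ∣ₓ P → P ≋ Q
monic-∣-antisym {P} {Q} m n (dividesₓ A Q≋PA) (dividesₓ B P≋QB) =
  ≋.sym (≋.trans Q≋PA (≋.trans (≋.*-congˡ {P} A≋1) (≋.*-identityʳ P)))
  where
  mA = monic-cofactor Q P A n m Q≋PA
  mB = monic-cofactor P Q B m n P≋QB
  deg-Q : proj₁ n ≡ proj₁ m ℕ.+ proj₁ mA
  deg-Q = degree-unique {P *ₚ A} (monic⇒degree (P *ₚ A) (monic-cong Q≋PA n)) (*ₚ-degree {P} {A} (monic⇒degree P m) (monic⇒degree A mA))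
  deg-P : proj₁ m ≡ proj₁ n ℕ.+ proj₁ mB
  deg-P = degree-unique {Q *ₚ B} (monic⇒degree (Q *ₚ B) (monic-cong P≋QB m)) (*ₚ-degree {Q} {B} (monic⇒degree Q n) (monic⇒degree B mB))
  deg-A : proj₁ mA ≡ 0
  deg-A = ℕₚ.m+n≡0⇒m≡0 (proj₁ mA) (ℕₚ.+-cancelˡ-≡ (proj₁ m) _ _ (≡.trans (≡.sym (ℕₚ.+-assoc (proj₁ m) (proj₁ mA) (proj₁ mB)))
    (≡.trans (cong (ℕ._+ proj₁ mB) (≡.sym deg-Q)) (≡.trans (≡.sym deg-P) (≡.sym (ℕₚ.+-identityʳ _))))))
  A≋1 : A ≋ oneₚ
  A≋1 = degree-0⇒one {A} (subst (λ d → MonicOfDegree d A) deg-A (proj₂ mA))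

∣1⇒≋1 : ∀ {Q} → Monic Q → Q ∣ₓ oneₚ → Q ≋ oneₚ
∣1⇒≋1 {Q} m d = monic-∣-antisym {Q} {oneₚ} m monic-one d (dividesₓ Q (≋.sym (≋.*-identityˡ Q)))

abstract
  -- The remainder decides: a nonzero multiple of `Q` has degree at least `d`, so a nonzero `R`
  -- excludes divisibility.
  _∣ₓ?_ : ∀ {Q} → Monic Q → ∀ A → Dec (Q ∣ₓ A)
  _∣ₓ?_ {Q} m@(d , c , h) A = helper (R ≋0?)
    where
    open PseudoDivision (pseudoDivision Q h A)
    open ≋-Reasoning
    A≋QE+R : A ≋ Q *ₚ E +ₚ R
    A≋QE+R = begin
      A                              ≈⟨ ≋.*-identityˡ A ⟨
      const (+ 1) *ₚ A               ≈⟨ ≋.*-congʳ {A} (const-cong (≡.trans (cong (ℤ._^ t) c) (ℤₚ.^-zeroˡ t))) ⟨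
      const (coeff Q d ℤ.^ t) *ₚ A   ≈⟨ equation ⟩
      Q *ₚ E +ₚ R                    ∎
    lem : ∀ Q E R → R ≋ (Q *ₚ E +ₚ R) +ₚ (-ₚ (Q *ₚ E))
    lem = solve-∀ ℤ[x]
    lem′ : ∀ Q E W → Q *ₚ W +ₚ (-ₚ (Q *ₚ E)) ≋ Q *ₚ (W +ₚ (-ₚ E))
    lem′ = solve-∀ ℤ[x]
    helper : Dec (R ≋ []) → Dec (Q ∣ₓ A)
    helper (yes R≋0) = yes (dividesₓ E (≋.trans A≋QE+R (≋.trans (≋.+-congˡ {Q *ₚ E} R≋0) (≋.+-identityʳ _))))
    helper (no R≉0)  = no λ { (dividesₓ W A≋QW) →
      let R≋QV : R ≋ Q *ₚ (W +ₚ (-ₚ E))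
          R≋QV = ≋.trans (lem Q E R) (≋.trans (≋.+-congʳ {(-ₚ (Q *ₚ E))} (≋.trans (≋.sym A≋QE+R) A≋QW)) (lem′ Q E W))
      in case degree? (W +ₚ (-ₚ E)) of λ where
           (inj₁ V≋0) → R≉0 (≋.trans R≋QV (≋.trans (≋.*-congˡ {Q} V≋0) (≋.zeroʳ Q)))
           (inj₂ (v , k)) → proj₁ (*ₚ-degree {Q} {W +ₚ (-ₚ E)} (monic⇒degree Q m) k)
             (DegLt-cong R≋QV remainder (d ℕ.+ v) (ℕₚ.m≤m+n d v)) }

-- A unit of ℤ is recorded by its square being 1, so that either sign is undone by the same
-- multiplication.
i*i≡1 : ∀ {a b} → a ℤ.* b ≡ + 1 → a ℤ.* a ≡ + 1
i*i≡1 {a} {b} e with a | ℕₚ.m*n≡1⇒m≡1 ∣ a ∣ ∣ b ∣ (≡.trans (≡.sym (ℤₚ.abs-* a b)) (cong ∣_∣ e))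
... | + 1       | refl = refl
... | -[1+ 0 ]  | refl = refl

-- Gauss's lemma gives `A = D₀ S₀` with `Q = d D₀`; as `Q` is monic, `d` is a unit, so `D₀` is `Q`
-- up to sign.
monic-∣-const* : ∀ {Q A c} → Monic Q → c ≢ + 0 → Q ∣ₓ const c *ₚ A → Q ∣ₓ A
monic-∣-const* {Q} {A} {c} (n , q≡1 , _) c≢0 (dividesₓ E cA≋QE) = dividesₓ (const d *ₚ S₀) (begin
    A                                       ≈⟨ A≋D₀S₀ ⟩
    D₀ *ₚ S₀                                ≈⟨ ≋.*-identityˡ _ ⟨
    const (+ 1) *ₚ (D₀ *ₚ S₀)               ≈⟨ ≋.*-congʳ (const-cong (i*i≡1 {d} {coeff D₀ n} unit)) ⟨
    const (d ℤ.* d) *ₚ (D₀ *ₚ S₀)           ≈⟨ ≋.*-congʳ (const-* d d) ⟩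
    const d *ₚ const d *ₚ (D₀ *ₚ S₀)        ≈⟨ lem (const d) D₀ S₀ ⟩
    (const d *ₚ D₀) *ₚ (const d *ₚ S₀)      ≈⟨ ≋.*-congʳ D≋dD₀ ⟨
    Q *ₚ (const d *ₚ S₀)                    ∎)
  where
  open GaussSplit (gaussSplit c c≢0 {A} {Q} {E} cA≋QE)
  open ≋-Reasoning
  unit : d ℤ.* coeff D₀ n ≡ + 1
  unit = ≡.trans (≡.sym (≡.trans (≋⇒≈ₚ D≋dD₀ n) (coeff-const-*ₚ d D₀ n))) q≡1
  lem : ∀ d D S → d *ₚ d *ₚ (D *ₚ S) ≋ (d *ₚ D) *ₚ (d *ₚ S)
  lem = solve-∀ ℤ[x]

-- Irreducible polynomials are prime

-- A greatest common divisor over ℚ with denominators cleared. `ℤ[x]` has no Bézout identity in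
-- general, so `D` divides `A` and `B` only up to the nonzero constants `c` and `e`.
record PseudoGCD (A B : Poly) : Set where
  field
    D U V S T : Poly
    c e       : ℤ
    c≢0       : c ≢ + 0
    e≢0       : e ≢ + 0
    bezout    : D ≋ U *ₚ A +ₚ V *ₚ B
    cA≋DS     : const c *ₚ A ≋ D *ₚ S
    eB≋DT     : const e *ₚ B ≋ D *ₚ T

^-≢0 : ∀ {b} t → b ≢ + 0 → b ℤ.^ t ≢ + 0
^-≢0 zero    b≢0 ()
^-≢0 (suc t) b≢0 = *-≢0 b≢0 (^-≢0 t b≢0)

-- Euclid's algorithm on pseudo-remainders, with `n` bounding the degree of `B`. The relations for
-- `(B , R)` are substituted back through `R = b A - B E`, which multiplies the constants.
pseudoGCD : ∀ n A B → DegLt n B → ¬ B ≋ [] → PseudoGCD A B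
pseudoGCD zero    A B h B≉0 = contradiction (DegLt-0 h) B≉0
pseudoGCD (suc n) A B h B≉0 with degree? B
... | inj₁ B≋0 = contradiction B≋0 B≉0
... | inj₂ (d , b≢0 , k) = helper (R ≋0?)
  where
  open PseudoDivision (pseudoDivision B k A)
  b = coeff B d ℤ.^ t
  d≤n : d ≤ n
  d≤n = ℕₚ.≮⇒≥ λ n<d → b≢0 (h d n<d)
  helper : Dec (R ≋ []) → PseudoGCD A B
  helper (yes R≋0) = record
    { D = B ; U = [] ; V = oneₚ ; S = E ; T = oneₚ ; c = b ; e = + 1 ; c≢0 = ^-≢0 t b≢0 ; e≢0 = λ ()
    ; bezout = ≋.sym (≋.*-identityˡ B)
    ; cA≋DS = ≋.trans equation (≋.trans (≋.+-congˡ {B *ₚ E} R≋0) (≋.+-identityʳ _))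
    ; eB≋DT = ≋.*-comm oneₚ B }
  helper (no R≉0) = record
    { D = D ; U = V *ₚ const b ; V = U +ₚ (-ₚ (V *ₚ E))
    ; S = const e *ₚ (S *ₚ E) +ₚ const c *ₚ T ; T = S
    ; c = c ℤ.* e ℤ.* b ; e = c
    ; c≢0 = *-≢0 {c ℤ.* e} (*-≢0 c≢0 e≢0) (^-≢0 t b≢0) ; e≢0 = c≢0
    ; bezout = ≋.trans bezout (≋.trans (≋.+-congˡ {U *ₚ B} (≋.*-congˡ {V} R≋)) (lem₂ U V B E (const b) A))
    ; cA≋DS = begin
        const (c ℤ.* e ℤ.* b) *ₚ A
          ≈⟨ ≋.*-congʳ {A} (≋.trans (const-* (c ℤ.* e) b) (≋.*-congʳ {const b} (const-* c e))) ⟩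
        const c *ₚ const e *ₚ const b *ₚ A
          ≈⟨ ≋.*-assoc (const c *ₚ const e) (const b) A ⟩
        const c *ₚ const e *ₚ (const b *ₚ A)
          ≈⟨ ≋.*-congˡ {const c *ₚ const e} equation ⟩
        const c *ₚ const e *ₚ (B *ₚ E +ₚ R)
          ≈⟨ lem₃ (const c) (const e) B E R ⟩
        const e *ₚ ((const c *ₚ B) *ₚ E) +ₚ const c *ₚ (const e *ₚ R)
          ≈⟨ ≋.+-cong (≋.*-congˡ {const e} (≋.*-congʳ {E} cA≋DS)) (≋.*-congˡ {const c} eB≋DT) ⟩
        const e *ₚ ((D *ₚ S) *ₚ E) +ₚ const c *ₚ (D *ₚ T)
          ≈⟨ lem₄ (const e) D S E (const c) T ⟩
        D *ₚ (const e *ₚ (S *ₚ E) +ₚ const c *ₚ T) ∎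
    ; eB≋DT = cA≋DS }
    where
    open ≋-Reasoning
    open PseudoGCD (pseudoGCD n B R (λ i l → remainder i (ℕₚ.≤-trans d≤n l)) R≉0)
    lem₁ : ∀ B E R → R ≋ (B *ₚ E +ₚ R) +ₚ (-ₚ (B *ₚ E))
    lem₁ = solve-∀ ℤ[x]
    R≋ : R ≋ const b *ₚ A +ₚ (-ₚ (B *ₚ E))
    R≋ = ≋.trans (lem₁ B E R) (≋.+-congʳ {(-ₚ (B *ₚ E))} (≋.sym equation))
    lem₂ : ∀ U V B E b A → U *ₚ B +ₚ V *ₚ (b *ₚ A +ₚ (-ₚ (B *ₚ E))) ≋ (V *ₚ b) *ₚ A +ₚ (U +ₚ (-ₚ (V *ₚ E))) *ₚ B
    lem₂ = solve-∀ ℤ[x]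
    lem₃ : ∀ c e B E R → c *ₚ e *ₚ (B *ₚ E +ₚ R) ≋ e *ₚ ((c *ₚ B) *ₚ E) +ₚ c *ₚ (e *ₚ R)
    lem₃ = solve-∀ ℤ[x]
    lem₄ : ∀ e D S E c T → e *ₚ ((D *ₚ S) *ₚ E) +ₚ c *ₚ (D *ₚ T) ≋ D *ₚ (e *ₚ (S *ₚ E) +ₚ c *ₚ T)
    lem₄ = solve-∀ ℤ[x]

unit⇒const : ∀ {P} → IsUnit P → ∃ λ u → u ≢ + 0 × u ℤ.* u ≡ + 1 × P ≋ const u
unit⇒const (inj₁ e) = + 1 , (λ ()) , refl , ≈ₚ⇒PolyEq e
unit⇒const (inj₂ e) = -[1+ 0 ] , (λ ()) , refl , ≈ₚ⇒PolyEq e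

abstract
  -- Let `D` be the pseudo-gcd of `A` and `Q`. Gauss's lemma applied to `e Q = D T` gives
  -- `Q = D₀ S₀` with `D = d D₀`, and one of `D₀`, `S₀` is a unit. If `D₀` is, then `D` is constant
  -- and the Bézout relation times `B` puts a constant multiple of `B` among the multiples of `Q`;
  -- if `S₀` is, then `Q` divides `D`, hence `c A`.
  irreducible⇒prime : ∀ {Q} → Monic Q → Irreducible Q → ∀ A B → Q ∣ₓ A *ₚ B → Q ∣ₓ A ⊎ Q ∣ₓ B
  irreducible⇒prime {Q} m@(n , _ , h) (_ , _ , irr) A B (dividesₓ W AB≋QW) =
    [ inj₂ ∘ D₀-unit ∘ unit⇒const , inj₁ ∘ S₀-unit ∘ unit⇒const ]′ (irr D₀ S₀ (≋⇒≈ₚ A≋D₀S₀))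
    where
    open PseudoGCD (pseudoGCD (suc n) A Q h (monic≉0 {Q} m))
    open GaussSplit (gaussSplit e e≢0 {Q} {D} {T} eB≋DT)
      using (D₀; S₀; d; A≋D₀S₀; D≋dD₀)
    open ≋-Reasoning
    -- With `d = 0` both `D` and `e Q` would vanish.
    d≢0 : d ≢ + 0
    d≢0 d≡0 = [ e≢0 ∘ const≋0 , monic≉0 {Q} m ]′ (*ₚ≈0 0-noZeroDivisors (const e) Q (begin
      const e *ₚ Q             ≈⟨ eB≋DT ⟩
      D *ₚ T                   ≈⟨ ≋.*-congʳ {T} D≋dD₀ ⟩
      const d *ₚ D₀ *ₚ T       ≈⟨ ≋.*-congʳ {T} (≋.*-congʳ {D₀} (≋.trans (const-cong d≡0) (0∷≈[] polyRefl))) ⟩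
      []                       ∎))
    D₀-unit : (∃ λ u → u ≢ + 0 × u ℤ.* u ≡ + 1 × D₀ ≋ const u) → Q ∣ₓ B
    D₀-unit (u , u≢0 , _ , D₀≋u) = monic-∣-const* {Q} {B} {d ℤ.* u} m (*-≢0 d≢0 u≢0) (dividesₓ (U *ₚ W +ₚ V *ₚ B) (begin
      const (d ℤ.* u) *ₚ B           ≈⟨ ≋.*-congʳ {B} (const-* d u) ⟩
      const d *ₚ const u *ₚ B        ≈⟨ ≋.*-congʳ {B} (≋.*-congˡ {const d} D₀≋u) ⟨
      const d *ₚ D₀ *ₚ B             ≈⟨ ≋.*-congʳ {B} D≋dD₀ ⟨
      D *ₚ B                         ≈⟨ ≋.*-congʳ {B} bezout ⟩
      (U *ₚ A +ₚ V *ₚ Q) *ₚ B        ≈⟨ lem₁ U A V Q B ⟩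
      U *ₚ (A *ₚ B) +ₚ Q *ₚ (V *ₚ B) ≈⟨ ≋.+-congʳ {Q *ₚ (V *ₚ B)} (≋.*-congˡ {U} AB≋QW) ⟩
      U *ₚ (Q *ₚ W) +ₚ Q *ₚ (V *ₚ B) ≈⟨ lem₂ U Q W (V *ₚ B) ⟩
      Q *ₚ (U *ₚ W +ₚ V *ₚ B)        ∎))
      where
      lem₁ : ∀ U A V Q B → (U *ₚ A +ₚ V *ₚ Q) *ₚ B ≋ U *ₚ (A *ₚ B) +ₚ Q *ₚ (V *ₚ B)
      lem₁ = solve-∀ ℤ[x]
      lem₂ : ∀ U Q W Z → U *ₚ (Q *ₚ W) +ₚ Q *ₚ Z ≋ Q *ₚ (U *ₚ W +ₚ Z)
      lem₂ = solve-∀ ℤ[x]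
    S₀-unit : (∃ λ u → u ≢ + 0 × u ℤ.* u ≡ + 1 × S₀ ≋ const u) → Q ∣ₓ A
    S₀-unit (u , _ , uu≡1 , S₀≋u) = monic-∣-const* {Q} {A} {c} m c≢0 (dividesₓ (const u *ₚ const d *ₚ S) (begin
      const c *ₚ A                                     ≈⟨ cA≋DS ⟩
      D *ₚ S                                           ≈⟨ ≋.*-congʳ {S} D≋dD₀ ⟩
      const d *ₚ D₀ *ₚ S                               ≈⟨ ≋.*-identityˡ _ ⟨
      const (+ 1) *ₚ (const d *ₚ D₀ *ₚ S)              ≈⟨ ≋.*-congʳ {const d *ₚ D₀ *ₚ S} (const-cong uu≡1) ⟨
      const (u ℤ.* u) *ₚ (const d *ₚ D₀ *ₚ S)          ≈⟨ ≋.*-congʳ {const d *ₚ D₀ *ₚ S} (const-* u u) ⟩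
      const u *ₚ const u *ₚ (const d *ₚ D₀ *ₚ S)       ≈⟨ lem (const u) (const d) D₀ S ⟩
      (D₀ *ₚ const u) *ₚ (const u *ₚ const d *ₚ S)     ≈⟨ ≋.*-congʳ {const u *ₚ const d *ₚ S} (≋.*-congˡ {D₀} S₀≋u) ⟨
      (D₀ *ₚ S₀) *ₚ (const u *ₚ const d *ₚ S)          ≈⟨ ≋.*-congʳ {const u *ₚ const d *ₚ S} A≋D₀S₀ ⟨
      Q *ₚ (const u *ₚ const d *ₚ S)                   ∎))
      where
      lem : ∀ u d D S → u *ₚ u *ₚ (d *ₚ D *ₚ S) ≋ (D *ₚ u) *ₚ (u *ₚ d *ₚ S)
      lem = solve-∀ ℤ[x]

-- Irreducible factors

Irr : Poly → Set
Irr Q = Monic Q × Irreducible Q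

abstract
  unit? : ∀ P → Dec (IsUnit P)
  unit? P = map′ (Sum.map ≋⇒≈ₚ ≋⇒≈ₚ) (Sum.map ≈ₚ⇒PolyEq ≈ₚ⇒PolyEq) (P ≋? oneₚ ⊎-dec P ≋? const -[1+ 0 ])

square-one⇒unit : ∀ {P} u → u ℤ.* u ≡ + 1 → P ≋ const u → IsUnit P
square-one⇒unit (+ 1)             _  e = inj₁ (≋⇒≈ₚ e)
square-one⇒unit -[1+ 0 ]          _  e = inj₂ (≋⇒≈ₚ e)
square-one⇒unit (+ 0)             () e
square-one⇒unit (+ suc (suc n))   () e
square-one⇒unit -[1+ suc n ]      () e

unit⇒degree-0 : ∀ {P d} → IsUnit P → MonicOfDegree d P → d ≡ 0
unit⇒degree-0 {d = zero}  _ _ = refl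
unit⇒degree-0 {d = suc d} u (c , _) =
  case ≡.trans (≡.sym c) ([ (λ e → e (suc d)) , (λ e → e (suc d)) ]′ u) of λ ()

irr-degree>0 : ∀ {Q} (i : Irr Q) → 0 < proj₁ (proj₁ i)
irr-degree>0 {Q} ((zero , m) , ¬unit , _) = contradiction (inj₁ (≋⇒≈ₚ (degree-0⇒one {Q} m))) ¬unit
irr-degree>0 ((suc d , _) , _)            = s≤s z≤n

-- If `C` had no irreducible factor, it would itself be irreducible: a splitting into two nonunits
-- yields a monic factor of smaller degree, to which the recursion applies. The number `n` bounds
-- the degree.
irreducibleFactor : ∀ n C d → d ≤ n → 0 < d → MonicOfDegree d C → ¬ ¬ (∃ λ Q → Irr Q × Q ∣ₓ C)
irreducibleFactor zero    C (suc d) () _ _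
irreducibleFactor (suc n) C d d≤1+n 0<d m@(c , h) none =
  none (C , ((d , m) , nonunit , (λ e → monic≉0 {C} (d , m) (≈ₚ⇒PolyEq e)) , split) , ∣ₓ-refl)
  where
  nonunit : ¬ IsUnit C
  nonunit u = ℕₚ.<⇒≢ 0<d (≡.sym (unit⇒degree-0 {C} u m))
  split : ∀ A B → C ≈ₚ A *ₚ B → IsUnit A ⊎ IsUnit B
  split A B C≈AB with unit? A | unit? B
  ... | yes u | _     = inj₁ u
  ... | no _  | yes u = inj₂ u
  ... | no ¬u | no ¬v with degree? A | degree? B
  ...   | inj₁ A≋0 | _ = contradiction (≋.trans (≈ₚ⇒PolyEq C≈AB) (≋.*-congʳ {B} A≋0)) (monic≉0 {C} (d , m))
  ...   | _ | inj₁ B≋0 = contradiction (≋.trans (≈ₚ⇒PolyEq C≈AB) (≋.trans (≋.*-congˡ {A} B≋0) (≋.zeroʳ A))) (monic≉0 {C} (d , m))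
  ...   | inj₂ (a , hA@(_ , k)) | inj₂ (b , hB@(_ , k′)) =
    -- The leading coefficients satisfy `α β = 1`, so `α` is 1 or -1 and `α A` is monic; the
    -- cofactor `α B` absorbs the sign.
    ⊥-elim (irreducibleFactor n (const α *ₚ A) a (ℕₚ.≤-pred (ℕₚ.≤-trans a<d d≤1+n)) (ℕₚ.n≢0⇒n>0 a≢0) monicA
      λ { (Q , i , Q∣A) → none (Q , i , ∣ₓ-trans Q∣A (dividesₓ (const α *ₚ B) C≋)) })
    where
    open ≋-Reasoning
    C≋AB = ≈ₚ⇒PolyEq {0} C≈AB
    α = coeff A a
    β = coeff B b
    d≡a+b : d ≡ a ℕ.+ b
    d≡a+b = degree-unique {A *ₚ B} (monic⇒degree (A *ₚ B) (monic-cong C≋AB (d , m))) (*ₚ-degree {A} {B} hA hB)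
    αβ≡1 : α ℤ.* β ≡ + 1
    αβ≡1 = ≡.trans (≡.sym (proj₁ (*ₚ-top A B k k′))) (≡.trans (≡.sym (C≈AB (a ℕ.+ b))) (≡.trans (cong (coeff C) (≡.sym d≡a+b)) c))
    αα≡1 : α ℤ.* α ≡ + 1
    αα≡1 = i*i≡1 {α} {β} αβ≡1
    a≢0 : a ≢ 0
    a≢0 refl = ¬u (square-one⇒unit α αα≡1 (degree-0⇒const {A} k))
    b≢0 : b ≢ 0
    b≢0 refl = ¬v (square-one⇒unit β (i*i≡1 {β} {α} (≡.trans (ℤₚ.*-comm β α) αβ≡1)) (degree-0⇒const {B} k′))
    a<d : a < d
    a<d = subst (a <_) (≡.sym d≡a+b) (ℕₚ.m<m+n a (ℕₚ.n≢0⇒n>0 b≢0))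
    monicA : MonicOfDegree a (const α *ₚ A)
    monicA = ≡.trans (coeff-const-*ₚ α A a) αα≡1
           , λ i l → ≡.trans (coeff-const-*ₚ α A i) (≡.trans (cong (α ℤ.*_) (k i l)) (ℤₚ.*-zeroʳ α))
    lem : ∀ α A B → α *ₚ α *ₚ (A *ₚ B) ≋ (α *ₚ A) *ₚ (α *ₚ B)
    lem = solve-∀ ℤ[x]
    C≋ : C ≋ const α *ₚ A *ₚ (const α *ₚ B)
    C≋ = begin
      C                                     ≈⟨ C≋AB ⟩
      A *ₚ B                                ≈⟨ ≋.*-identityˡ _ ⟨
      const (+ 1) *ₚ (A *ₚ B)               ≈⟨ ≋.*-congʳ {A *ₚ B} (const-cong αα≡1) ⟨
      const (α ℤ.* α) *ₚ (A *ₚ B)           ≈⟨ ≋.*-congʳ {A *ₚ B} (const-* α α) ⟩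
      const α *ₚ const α *ₚ (A *ₚ B)        ≈⟨ lem (const α) A B ⟩
      const α *ₚ A *ₚ (const α *ₚ B)        ∎

irr-∤1 : ∀ {Q} → Irr Q → ¬ Q ∣ₓ oneₚ
irr-∤1 (m , ¬unit , _) d = ¬unit (inj₁ (≋⇒≈ₚ (∣1⇒≋1 m d)))

irr-∣-irr : ∀ {Q R} → Irr Q → Irr R → Q ∣ₓ R → Q ≋ R
irr-∣-irr {Q} {R} (m , ¬unit , _) (n , _ , _ , irr) d@(dividesₓ A R≋QA) =
  [ (λ u → contradiction u ¬unit) , A-unit ∘ unit⇒const ]′ (irr Q A (≋⇒≈ₚ R≋QA))
  where
  open ≋-Reasoning
  A-unit : (∃ λ u → u ≢ + 0 × u ℤ.* u ≡ + 1 × A ≋ const u) → Q ≋ R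
  A-unit (u , _ , uu≡1 , A≋u) = monic-∣-antisym {Q} {R} m n d (dividesₓ (const u) (begin
    Q                            ≈⟨ ≋.*-identityʳ Q ⟨
    Q *ₚ const (+ 1)             ≈⟨ ≋.*-congˡ {Q} (const-cong uu≡1) ⟨
    Q *ₚ const (u ℤ.* u)         ≈⟨ ≋.*-congˡ {Q} (const-* u u) ⟩
    Q *ₚ (const u *ₚ const u)    ≈⟨ ≋.*-assoc Q (const u) (const u) ⟨
    Q *ₚ const u *ₚ const u      ≈⟨ ≋.*-congʳ {const u} (≋.*-congˡ {Q} A≋u) ⟨
    Q *ₚ A *ₚ const u            ≈⟨ ≋.*-congʳ {const u} R≋QA ⟨
    R *ₚ const u                 ∎))

irr-∣-prod : ∀ {Q} → Irr Q → ∀ Rs → Q ∣ₓ prodₚ Rs → Any (Q ∣ₓ_) Rs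
irr-∣-prod i []       d = contradiction d (irr-∤1 i)
irr-∣-prod i (R ∷ Rs) d = [ here , there ∘ irr-∣-prod i Rs ]′ (irreducible⇒prime (proj₁ i) (proj₂ i) R (prodₚ Rs) d)

∣-prod : ∀ {Q} Rs → Any (Q ∣ₓ_) Rs → Q ∣ₓ prodₚ Rs
∣-prod (R ∷ Rs) (here d)  = ∣ₓ-m*n (prodₚ Rs) d
∣-prod (R ∷ Rs) (there a) = ∣ₓ-n*m R (∣-prod Rs a)

Distinct : List Poly → Set
Distinct = AllPairs (λ A B → ¬ A ≈ₚ B)

-- The next factor `Q` is prime and divides the product found so far times `Y`. Dividing the product
-- would make it equal to a listed factor, so it divides `Y`.
prod-distinct-∣ : ∀ {X} Qs → All Irr Qs → Distinct Qs → All (_∣ₓ X) Qs → prodₚ Qs ∣ₓ X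
prod-distinct-∣ {X} [] _ _ _ = dividesₓ X (≋.sym (≋.*-identityˡ X))
prod-distinct-∣ {X} (Q ∷ Qs) (i ∷ is) (≉Q ∷ distinct) (Q∣X ∷ ds) with prod-distinct-∣ Qs is distinct ds
... | dividesₓ Y X≋ΠY with irreducible⇒prime (proj₁ i) (proj₂ i) (prodₚ Qs) Y (∣ₓ-respʳ X≋ΠY Q∣X)
...   | inj₁ Q∣Π = contradiction (irr-∣-prod i Qs Q∣Π) (clash is ≉Q)
  where
  clash : ∀ {Rs} → All Irr Rs → All (λ R → ¬ Q ≈ₚ R) Rs → ¬ Any (Q ∣ₓ_) Rs
  clash (j ∷ _)  (≉ ∷ _)  (here d)  = ≉ (≋⇒≈ₚ (irr-∣-irr i j d))
  clash (_ ∷ js) (_ ∷ ≉s) (there a) = clash js ≉s a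
...   | inj₂ (dividesₓ Z Y≋QZ) = dividesₓ Z
  (≋.trans X≋ΠY (≋.trans (≋.*-congˡ {prodₚ Qs} Y≋QZ) (lem (prodₚ Qs) Q Z)))
  where lem : ∀ Π Q Z → Π *ₚ (Q *ₚ Z) ≋ Q *ₚ Π *ₚ Z
        lem = solve-∀ ℤ[x]

-- Divisibility and squarefreeness of Fibonacci polynomials

-- The filler value `F 0 = 0` is the one that extends the recurrence down to index 0; the addition
-- formula and the binomial expansion below rely on it.
F-rec-xmul : ∀ n → F (suc (suc n)) ≋ xmul (F (suc n)) +ₚ F n
F-rec-xmul zero    = ≋.refl
F-rec-xmul (suc n) = ≋.refl

F-rec : ∀ n → F (suc (suc n)) ≋ X *ₚ F (suc n) +ₚ F n
F-rec n = ≋.trans (F-rec-xmul n) (≋.+-congʳ {F n} (xmul≋X*ₚ (F (suc n))))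

F-+ : ∀ m n → F (suc m ℕ.+ n) ≋ F (suc m) *ₚ F (suc n) +ₚ F m *ₚ F n
F-+ zero          n = ≋.trans (≋.sym (≋.*-identityˡ _)) (≋.sym (≋.+-identityʳ _))
F-+ (suc zero)    n = ≋.trans (F-rec n) (≋.+-congˡ {X *ₚ F (suc n)} (≋.sym (≋.*-identityˡ (F n))))
F-+ (suc (suc m)) n = begin
  F (suc (suc (suc m)) ℕ.+ n)
    ≈⟨ F-rec (suc m ℕ.+ n) ⟩
  X *ₚ F (suc (suc m) ℕ.+ n) +ₚ F (suc m ℕ.+ n)
    ≈⟨ ≋.+-cong (≋.*-congˡ {X} (F-+ (suc m) n)) (F-+ m n) ⟩
  X *ₚ (F (2 ℕ.+ m) *ₚ F (suc n) +ₚ F (suc m) *ₚ F n) +ₚ (F (suc m) *ₚ F (suc n) +ₚ F m *ₚ F n)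
    ≈⟨ lem X (F (2 ℕ.+ m)) (F (suc m)) (F m) (F (suc n)) (F n) ⟩
  (X *ₚ F (2 ℕ.+ m) +ₚ F (suc m)) *ₚ F (suc n) +ₚ (X *ₚ F (suc m) +ₚ F m) *ₚ F n
    ≈⟨ ≋.+-cong (≋.*-congʳ {F (suc n)} (F-rec (suc m))) (≋.*-congʳ {F n} (F-rec m)) ⟨
  F (3 ℕ.+ m) *ₚ F (suc n) +ₚ F (2 ℕ.+ m) *ₚ F n ∎
  where
  open ≋-Reasoning
  lem : ∀ x a b c d e → x *ₚ (a *ₚ d +ₚ b *ₚ e) +ₚ (b *ₚ d +ₚ c *ₚ e) ≋ (x *ₚ a +ₚ b) *ₚ d +ₚ (x *ₚ b +ₚ c) *ₚ e
  lem = solve-∀ ℤ[x]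

F-monic : ∀ n → MonicOfDegree n (F (suc n))
F-monic zero          = refl , λ { (suc i) _ → refl }
F-monic (suc zero)    = refl , λ { (suc (suc i)) _ → refl ; (suc zero) (s≤s ()) }
F-monic (suc (suc n)) with F-monic (suc n) | F-monic n
... | c , h | _ , k =
  ≡.trans (coeff-+ₚ (xmul (F (2 ℕ.+ n))) (F (suc n)) (2 ℕ.+ n)) (cong₂ ℤ._+_ c (k (2 ℕ.+ n) (ℕₚ.n≤1+n _)))
  , λ { (suc i) (s≤s l) → ≡.trans (coeff-+ₚ (xmul (F (2 ℕ.+ n))) (F (suc n)) (suc i))
          (cong₂ ℤ._+_ (h i l) (k (suc i) (ℕₚ.≤-trans (ℕₚ.n≤1+n (suc n)) (ℕₚ.m≤n⇒m≤1+n l)))) }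

∣ₓ-[] : ∀ {P} → P ∣ₓ []
∣ₓ-[] {P} = dividesₓ [] (≋.sym (≋.zeroʳ P))

F-∣-multiple : ∀ d k → F d ∣ₓ F (k ℕ.* d)
F-∣-multiple d       zero    = ∣ₓ-[]
F-∣-multiple zero    (suc k) = F-∣-multiple zero k
F-∣-multiple (suc d) (suc k) = ∣ₓ-respʳ (≋.sym (F-+ d (k ℕ.* suc d)))
  (∣ₓ-+ (∣ₓ-m*n (F (suc (k ℕ.* suc d))) ∣ₓ-refl) (∣ₓ-n*m (F d) (F-∣-multiple (suc d) k)))

F-∣ : ∀ {d n} → d ℕᵈ.∣ n → F d ∣ₓ F n
F-∣ {d} (ℕᵈ.divides k refl) = F-∣-multiple d k

-- Read backwards, the recurrence carries a common factor of two neighbours down to `F 1 = 1`.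
F-consecutive : ∀ {Q} → Irr Q → ∀ n → Q ∣ₓ F n → ¬ Q ∣ₓ F (suc n)
F-consecutive i zero    _ d = irr-∤1 i d
F-consecutive i (suc n) d e = F-consecutive i n
  (∣ₓ-+-cancelˡ {A = X *ₚ F (suc n)} (F n) (∣ₓ-respʳ (F-rec n) e) (∣ₓ-n*m X d)) d

-- Descent from `n` to `r = n - d`: in `F n = F d · F (r+1) + F (d-1) · F r` the prime `Q` divides
-- `F n` and `F d` but not `F (d-1)`, hence divides `F r`.
newFactor-∣ : ∀ {Q d} → Irr Q → NewFactor d Q → 1 ≤ d → ∀ N n → n ≤ N → Q ∣ₓ F n → d ℕᵈ.∣ n
newFactor-∣ i new 1≤d N zero n≤N Q∣Fn = _ ℕᵈ.∣0
newFactor-∣ {Q} {suc d} i (Q∣Fd , minimal) 1≤d (suc N) n@(suc _) n≤N Q∣Fn with n ℕ.<? suc d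
... | yes n<d = contradiction (∣ₓ⇒∣ₚ Q∣Fn) (minimal n (s≤s z≤n) n<d)
... | no n≮d  = subst (suc d ℕᵈ.∣_) n≡ (ℕᵈ.∣m∣n⇒∣m+n ℕᵈ.∣-refl
    (newFactor-∣ i (Q∣Fd , minimal) 1≤d N r r≤N ([ (λ e → contradiction e (¬∣Fd d Q∣Fd minimal)) , (λ e → e) ]′
      (irreducible⇒prime (proj₁ i) (proj₂ i) (F d) (F r)
        (∣ₓ-+-cancelˡ {A = F (suc d) *ₚ F (suc r)} (F d *ₚ F r)
          (∣ₓ-respʳ (F-+ d r) (subst (λ t → Q ∣ₓ F t) (≡.sym n≡) Q∣Fn)) (∣ₓ-m*n {A = F (suc d)} (F (suc r)) (∣ₚ⇒∣ₓ {F (suc d)} Q∣Fd)))))))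
  where
  r = n ℕ.∸ suc d
  n≡ : suc d ℕ.+ r ≡ n
  n≡ = ℕₚ.m+[n∸m]≡n (ℕₚ.≮⇒≥ n≮d)
  r≤N : r ≤ N
  r≤N = ℕₚ.≤-trans (ℕₚ.m∸n≤m _ d) (ℕₚ.≤-pred n≤N)
  ¬∣Fd : ∀ d → Q ∣ₚ F (suc d) → (∀ k → 1 ≤ k → k < suc d → ¬ (Q ∣ₚ F k)) → ¬ Q ∣ₓ F d
  ¬∣Fd zero    Q∣F1 _ _    = irr-∤1 i (∣ₚ⇒∣ₓ {F 1} {Q} Q∣F1)
  ¬∣Fd (suc e) _    h Q∣Fe = h (suc e) (s≤s z≤n) ℕₚ.≤-refl (∣ₓ⇒∣ₚ Q∣Fe)

firstIndex : ∀ {Q} → Monic Q → ∀ N →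
  (∃ λ d → 1 ≤ d × d ≤ N × NewFactor d Q) ⊎ (∀ k → 1 ≤ k → k ≤ N → ¬ (Q ∣ₚ F k))
firstIndex m zero = inj₂ λ { (suc k) _ () }
firstIndex {Q} m (suc N) with firstIndex {Q} m N
... | inj₁ (d , 1≤d , d≤N , new) = inj₁ (d , 1≤d , ℕₚ.m≤n⇒m≤1+n d≤N , new)
... | inj₂ none with _∣ₓ?_ {Q} m (F (suc N))
...   | yes Q∣F = inj₁ (suc N , s≤s z≤n , ℕₚ.≤-refl , ∣ₓ⇒∣ₚ Q∣F , λ k 1≤k k<1+N → none k 1≤k (ℕₚ.≤-pred k<1+N))
...   | no Q∤F  = inj₂ λ k 1≤k k≤1+N Q∣Fk → case ℕₚ.m≤n⇒m<n∨m≡n k≤1+N of λ where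
  (inj₁ k<1+N) → none k 1≤k (ℕₚ.≤-pred k<1+N) Q∣Fk
  (inj₂ refl)  → Q∤F (∣ₚ⇒∣ₓ {F (suc N)} Q∣Fk)

newFactor-unique : ∀ {A B d e} → A ≋ B → 1 ≤ d → 1 ≤ e → NewFactor d A → NewFactor e B → d ≡ e
newFactor-unique {A} {B} {d} {e} A≋B 1≤d 1≤e (A∣Fd , minA) (B∣Fe , minB) = ℕₚ.≤-antisym
  (ℕₚ.≮⇒≥ λ e<d → minA e 1≤e e<d (∣ₓ⇒∣ₚ (∣ₓ-respˡ (≋.sym A≋B) (∣ₚ⇒∣ₓ {F e} B∣Fe))))
  (ℕₚ.≮⇒≥ λ d<e → minB d 1≤d d<e (∣ₓ⇒∣ₚ (∣ₓ-respˡ A≋B (∣ₚ⇒∣ₓ {F d} A∣Fd))))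

newFactor-cong : ∀ {A B d} → A ≋ B → NewFactor d A → NewFactor d B
newFactor-cong {d = n} e (d , h) = ∣ₓ⇒∣ₚ (∣ₓ-respˡ e (∣ₚ⇒∣ₓ {F n} d)) ,
  λ k 1≤k k<d d′ → h k 1≤k k<d (∣ₓ⇒∣ₚ (∣ₓ-respˡ (≋.sym e) (∣ₚ⇒∣ₓ {F k} d′)))

-- Formal derivatives and squarefreeness

-- The Leibniz rule for `a + x P`; the multipliers `n` in `n x^(n-1)` arise by repeated addition.
der : Poly → Poly
der []      = []
der (a ∷ P) = P +ₚ xmul (der P)

der-zero : ∀ {P} → P ≋ [] → der P ≋ []
der-zero {[]}    e = ≋.refl
der-zero {a ∷ P} e = ≋.+-cong {P} {[]} (tail≈0 e) (0∷≈[] (der-zero (tail≈0 e)))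

der-cong : ∀ P Q → P ≋ Q → der P ≋ der Q
der-cong []      Q       e = ≋.sym (der-zero (≋.sym e))
der-cong (a ∷ P) []      e = der-zero e
der-cong (a ∷ P) (b ∷ Q) e = ≋.+-cong (tail-cong e) (∷-cong (≡⇒ModEq refl) (der-cong P Q (tail-cong e)))

der-+ₚ : ∀ P Q → der (P +ₚ Q) ≋ der P +ₚ der Q
der-+ₚ []      Q       = ≋.refl
der-+ₚ (a ∷ P) []      = ≋.sym (≋.+-identityʳ _)
der-+ₚ (a ∷ P) (b ∷ Q) = ≋.trans (≋.+-congˡ {P +ₚ Q} (∷-cong (≡⇒ModEq refl) (der-+ₚ P Q)))
  (+ₚ-interchange P Q (xmul (der P)) (xmul (der Q)))

der-scale : ∀ a P → der (scale a P) ≋ scale a (der P)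
der-scale a []      = ≋.refl
der-scale a (b ∷ P) = ≋.sym (≋.trans (scale-+ₚ a P (xmul (der P)))
  (≋.+-congˡ {scale a P} (≋.trans (scale-xmul a (der P)) (∷-cong (≡⇒ModEq refl) (≋.sym (der-scale a P))))))

der-*ₚ : ∀ P Q → der (P *ₚ Q) ≋ der P *ₚ Q +ₚ P *ₚ der Q
der-*ₚ []      Q = ≋.refl
der-*ₚ (a ∷ P) Q = begin
  der (scale a Q +ₚ xmul (P *ₚ Q))
    ≈⟨ der-+ₚ (scale a Q) (xmul (P *ₚ Q)) ⟩
  der (scale a Q) +ₚ (P *ₚ Q +ₚ xmul (der (P *ₚ Q)))
    ≈⟨ ≋.+-cong (≋.trans (der-scale a Q) (≋.sym (const-*ₚ a (der Q))))
         (≋.+-congˡ {P *ₚ Q} (≋.trans (∷-cong (≡⇒ModEq refl) (der-*ₚ P Q)) (xmul≋X*ₚ (der P *ₚ Q +ₚ P *ₚ der Q)))) ⟩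
  const a *ₚ der Q +ₚ (P *ₚ Q +ₚ X *ₚ (der P *ₚ Q +ₚ P *ₚ der Q))
    ≈⟨ lem (const a) (der Q) P Q X (der P) ⟩
  (P +ₚ X *ₚ der P) *ₚ Q +ₚ (const a *ₚ der Q +ₚ X *ₚ (P *ₚ der Q))
    ≈⟨ ≋.+-cong (≋.*-congʳ {Q} (≋.+-congˡ {P} (xmul≋X*ₚ (der P))))
         (≋.+-cong (≋.sym (const-*ₚ a (der Q))) (xmul≋X*ₚ (P *ₚ der Q))) ⟨
  (P +ₚ xmul (der P)) *ₚ Q +ₚ (scale a (der Q) +ₚ xmul (P *ₚ der Q)) ∎
  where
  open ≋-Reasoning
  lem : ∀ a Q′ P Q X P′ → a *ₚ Q′ +ₚ (P *ₚ Q +ₚ X *ₚ (P′ *ₚ Q +ₚ P *ₚ Q′)) ≋ (P +ₚ X *ₚ P′) *ₚ Q +ₚ (a *ₚ Q′ +ₚ X *ₚ (P *ₚ Q′))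
  lem = solve-∀ ℤ[x]

square-∣⇒∣-der : ∀ {Q P} → Q *ₚ Q ∣ₓ P → Q ∣ₓ der P
square-∣⇒∣-der {Q} {P} (dividesₓ A P≋QQA) = ∣ₓ-respʳ
  (≋.sym (≋.trans (der-cong P (Q *ₚ (Q *ₚ A)) (≋.trans P≋QQA (≋.*-assoc Q Q A))) (der-*ₚ Q (Q *ₚ A))))
  (∣ₓ-+ (∣ₓ-n*m (der Q) (∣ₓ-m*n A ∣ₓ-refl)) (∣ₓ-m*n (der (Q *ₚ A)) ∣ₓ-refl))

-- (x² + 4) Fₙ′ = n Lₙ − x Fₙ, where Lₙ = 2 Fₙ₊₁ − x Fₙ is the n-th Lucas polynomial.
der-F : ∀ n → (X *ₚ X +ₚ const (+ 4)) *ₚ der (F n) ≋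
  const (+ n) *ₚ (const (+ 2) *ₚ F (suc n) +ₚ (-ₚ (X *ₚ F n))) +ₚ (-ₚ (X *ₚ F n))
der-F zero          = ≈ₚ⇒PolyEq λ { 0 → refl ; 1 → refl ; 2 → refl ; (suc (suc (suc i))) → refl }
der-F (suc zero)    = ≈ₚ⇒PolyEq λ { 0 → refl ; 1 → refl ; 2 → refl ; (suc (suc (suc i))) → refl }
der-F (suc (suc n)) = begin
  (X *ₚ X +ₚ const (+ 4)) *ₚ der f₂
    ≈⟨ ≋.*-congˡ {X *ₚ X +ₚ const (+ 4)} der-f₂ ⟩
  (X *ₚ X +ₚ const (+ 4)) *ₚ (f₁ +ₚ X *ₚ der f₁ +ₚ der f₀)
    ≈⟨ lem₁ X f₁ (der f₁) (der f₀) ⟩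
  (X *ₚ X +ₚ const (+ 4)) *ₚ f₁ +ₚ X *ₚ ((X *ₚ X +ₚ const (+ 4)) *ₚ der f₁) +ₚ (X *ₚ X +ₚ const (+ 4)) *ₚ der f₀
    ≈⟨ ≋.+-cong (≋.+-congˡ {(X *ₚ X +ₚ const (+ 4)) *ₚ f₁} (≋.*-congˡ {X} (≋.trans (der-F (suc n))
         (≋.+-congʳ {(-ₚ (X *ₚ f₁))} (≋.*-congˡ {const (+ suc n)} (≋.+-congʳ {(-ₚ (X *ₚ f₁))} (≋.*-congˡ {const (+ 2)} (F-rec n)))))))) (der-F n) ⟩
  (X *ₚ X +ₚ const (+ 4)) *ₚ f₁
    +ₚ X *ₚ ((oneₚ +ₚ ν) *ₚ (const (+ 2) *ₚ (X *ₚ f₁ +ₚ f₀) +ₚ (-ₚ (X *ₚ f₁))) +ₚ (-ₚ (X *ₚ f₁)))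
    +ₚ (ν *ₚ (const (+ 2) *ₚ f₁ +ₚ (-ₚ (X *ₚ f₀))) +ₚ (-ₚ (X *ₚ f₀)))
    ≈⟨ lem₂ X f₀ f₁ ν ⟩
  (oneₚ +ₚ (oneₚ +ₚ ν)) *ₚ (const (+ 2) *ₚ (X *ₚ (X *ₚ f₁ +ₚ f₀) +ₚ f₁) +ₚ (-ₚ (X *ₚ (X *ₚ f₁ +ₚ f₀)))) +ₚ (-ₚ (X *ₚ (X *ₚ f₁ +ₚ f₀)))
    ≈⟨ ≋.+-cong (≋.*-congˡ {const (+ suc (suc n))} (≋.+-cong (≋.*-congˡ {const (+ 2)} F₃) (≋.-‿cong (≋.*-congˡ {X} (F-rec n)))))
         (≋.-‿cong (≋.*-congˡ {X} (F-rec n))) ⟨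
  const (+ suc (suc n)) *ₚ (const (+ 2) *ₚ F (3 ℕ.+ n) +ₚ (-ₚ (X *ₚ f₂))) +ₚ (-ₚ (X *ₚ f₂)) ∎
  where
  open ≋-Reasoning
  ν  = const (+ n)
  f₀ = F n
  f₁ = F (suc n)
  f₂ = F (suc (suc n))
  F₃ : F (3 ℕ.+ n) ≋ X *ₚ (X *ₚ f₁ +ₚ f₀) +ₚ f₁
  F₃ = ≋.trans (F-rec (suc n)) (≋.+-congʳ {f₁} (≋.*-congˡ {X} (F-rec n)))
  der-f₂ : der f₂ ≋ f₁ +ₚ X *ₚ der f₁ +ₚ der f₀
  der-f₂ = ≋.trans (der-cong f₂ (xmul f₁ +ₚ f₀) (F-rec-xmul n)) (≋.trans (der-+ₚ (xmul f₁) f₀)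
    (≋.+-congʳ {der f₀} (≋.+-congˡ {f₁} (xmul≋X*ₚ (der f₁)))))
  lem₁ : ∀ x f d e → (x *ₚ x +ₚ const (+ 4)) *ₚ (f +ₚ x *ₚ d +ₚ e)
    ≋ (x *ₚ x +ₚ const (+ 4)) *ₚ f +ₚ x *ₚ ((x *ₚ x +ₚ const (+ 4)) *ₚ d) +ₚ (x *ₚ x +ₚ const (+ 4)) *ₚ e
  lem₁ = solve-∀ ℤ[x]
  lem₂ : ∀ x f₀ f₁ ν → (x *ₚ x +ₚ const (+ 4)) *ₚ f₁
    +ₚ x *ₚ ((oneₚ +ₚ ν) *ₚ (const (+ 2) *ₚ (x *ₚ f₁ +ₚ f₀) +ₚ (-ₚ (x *ₚ f₁))) +ₚ (-ₚ (x *ₚ f₁)))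
    +ₚ (ν *ₚ (const (+ 2) *ₚ f₁ +ₚ (-ₚ (x *ₚ f₀))) +ₚ (-ₚ (x *ₚ f₀)))
    ≋ (oneₚ +ₚ (oneₚ +ₚ ν)) *ₚ (const (+ 2) *ₚ (x *ₚ (x *ₚ f₁ +ₚ f₀) +ₚ f₁) +ₚ (-ₚ (x *ₚ (x *ₚ f₁ +ₚ f₀)))) +ₚ (-ₚ (x *ₚ (x *ₚ f₁ +ₚ f₀)))
  lem₂ = solve-∀ ℤ[x]

-- A square factor also divides the derivative, and the identity for it leaves
-- `Q ∣ 2 (n+1) F (n+2)`. The integer is dropped because `Q` is monic, and `Q` then divides two
-- neighbours.
F-squarefree : ∀ {Q} → Irr Q → ∀ n → ¬ Q *ₚ Q ∣ₓ F (suc n)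
F-squarefree {Q} i n QQ∣F = F-consecutive i (suc n) Q∣F (monic-∣-const* {Q} {F (2 ℕ.+ n)} {+ suc n ℤ.* + 2}
  (proj₁ i) (*-≢0 {+ suc n} {+ 2} (λ ()) (λ ())) Q∣2nF)
  where
  f₁ = F (suc n)
  f₂ = F (suc (suc n))
  ν  = const (+ suc n)
  Q∣F : Q ∣ₓ f₁
  Q∣F = ∣ₓ-trans (∣ₓ-m*n Q ∣ₓ-refl) QQ∣F
  lem : ∀ ν x f g → ν *ₚ (const (+ 2) *ₚ g +ₚ (-ₚ (x *ₚ f))) +ₚ (-ₚ (x *ₚ f)) +ₚ (ν *ₚ x +ₚ x) *ₚ f ≋ ν *ₚ const (+ 2) *ₚ g
  lem = solve-∀ ℤ[x]
  Q∣2nF : Q ∣ₓ const (+ suc n ℤ.* + 2) *ₚ f₂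
  Q∣2nF = ∣ₓ-respʳ (≋.trans (≋.+-congʳ {(ν *ₚ X +ₚ X) *ₚ f₁} (der-F (suc n)))
      (≋.trans (lem ν X f₁ f₂) (≋.*-congʳ {f₂} (≋.sym (const-* (+ suc n) (+ 2))))))
    (∣ₓ-+ (∣ₓ-n*m (X *ₚ X +ₚ const (+ 4)) (square-∣⇒∣-der {Q} {f₁} QQ∣F)) (∣ₓ-n*m (ν *ₚ X +ₚ X) Q∣F))

-- Fibotomic factorisation of Fibonacci polynomials

-- The clauses of `IsFibotomic` on the list alone. They make sense at `n = 1` too, where they force
-- the empty list, so products over divisors can include the index 1.
FactorList : ℕ → List Poly → Set
FactorList n Qs = All Irr Qs × Distinct Qs ×
  (∀ Q → Monic Q → Irreducible Q → (Any (λ R → R ≈ₚ Q) Qs ⇔ NewFactor n Q))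

-- Completeness is relative to the divisors of `C`, which permits induction on the degree of `C`; at
-- `C = F n` the restriction is vacuous.
record FactorsIn (n : ℕ) (C : Poly) : Set where
  field
    factors     : List Poly
    irreducible : All Irr factors
    distinct    : Distinct factors
    sound       : ∀ Q → Irr Q → Any (λ R → R ≈ₚ Q) factors → NewFactor n Q
    complete    : ∀ Q → Irr Q → NewFactor n Q → Q ∣ₓ C → Any (λ R → R ≈ₚ Q) factors

any-resp : ∀ {Q Q′ Rs} → Q ≋ Q′ → Any (λ R → R ≈ₚ Q) Rs → Any (λ R → R ≈ₚ Q′) Rs
any-resp e = Any.map λ f i → ≡.trans (f i) (≋⇒≈ₚ e i)

-- An irreducible factor `Q₀` is split off and the cofactor treated recursively. Whether `Q₀` is new
-- at `n` and whether it is already listed are both decided under the double negation.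
factorsIn : ∀ n t C d → d ≤ t → MonicOfDegree d C → ¬ ¬ FactorsIn n C
factorsIn n t C zero _ m k = k record
  { factors = [] ; irreducible = [] ; distinct = [] ; sound = λ { _ _ () }
  ; complete = λ Q i _ Q∣C → contradiction (∣ₓ-respʳ (degree-0⇒one {C} m) Q∣C) (irr-∤1 {Q} i) }
factorsIn n (suc t) C d@(suc _) d≤1+t m k =
  irreducibleFactor d C d ℕₚ.≤-refl (s≤s z≤n) m λ { (Q₀ , i₀ , dividesₓ C′ C≋Q₀C′) →
    let m′ : Monic C′
        m′ = monic-cofactor C Q₀ C′ (d , m) (proj₁ i₀) C≋Q₀C′
        d≡ : d ≡ proj₁ (proj₁ i₀) ℕ.+ proj₁ m′
        d≡ = degree-unique {Q₀ *ₚ C′} (monic⇒degree (Q₀ *ₚ C′) (monic-cong C≋Q₀C′ (d , m)))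
               (*ₚ-degree {Q₀} {C′} (monic⇒degree Q₀ (proj₁ i₀)) (monic⇒degree C′ m′))
        d′<d : proj₁ m′ < d
        d′<d = subst (proj₁ m′ <_) (≡.sym d≡) (ℕₚ.m<n+m (proj₁ m′) (irr-degree>0 {Q₀} i₀))
    in factorsIn n t C′ (proj₁ m′) (ℕₚ.≤-pred (ℕₚ.≤-trans d′<d d≤1+t)) (proj₂ m′) λ fs →
       ¬¬-excluded-middle {A = NewFactor n Q₀} λ new? →
       ¬¬-excluded-middle {A = Any (λ R → R ≈ₚ Q₀) (FactorsIn.factors fs)} λ listed? →
       k (extend Q₀ i₀ C′ C≋Q₀C′ fs new? listed?) }
  where
  extend : ∀ Q₀ → Irr Q₀ → ∀ C′ → C ≋ Q₀ *ₚ C′ → (fs : FactorsIn n C′) →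
    Dec (NewFactor n Q₀) → Dec (Any (λ R → R ≈ₚ Q₀) (FactorsIn.factors fs)) → FactorsIn n C
  extend Q₀ i₀ C′ C≋Q₀C′ fs new? listed? = go new? listed?
    where
    open FactorsIn fs
    factorOf : ∀ Q → Irr Q → Q ∣ₓ C → Q₀ ≋ Q ⊎ Q ∣ₓ C′
    factorOf Q i Q∣C = Sum.map₁ (λ d → ≋.sym (irr-∣-irr {Q} {Q₀} i i₀ d))
      (irreducible⇒prime (proj₁ i) (proj₂ i) Q₀ C′ (∣ₓ-respʳ C≋Q₀C′ Q∣C))
    go : Dec (NewFactor n Q₀) → Dec (Any (λ R → R ≈ₚ Q₀) factors) → FactorsIn n C
    go (yes new) (no ¬listed) = record
      { factors = Q₀ ∷ factors ; irreducible = i₀ ∷ irreducible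
      ; distinct = All.tabulate (λ {R} R∈ Q₀≈R → ¬listed (Any.map (λ { refl j → ≡.sym (Q₀≈R j) }) R∈)) ∷ distinct
      ; sound = λ { Q i (here Q₀≈Q) → newFactor-cong {Q₀} {Q} (≈ₚ⇒PolyEq Q₀≈Q) new ; Q i (there a) → sound Q i a }
      ; complete = λ Q i newQ Q∣C → [ (λ e → here (≋⇒≈ₚ e)) , (λ d → there (complete Q i newQ d)) ]′ (factorOf Q i Q∣C) }
    go (yes new) (yes listed) = record
      { factors = factors ; irreducible = irreducible ; distinct = distinct ; sound = sound
      ; complete = λ Q i newQ Q∣C → [ (λ e → any-resp e listed) , complete Q i newQ ]′ (factorOf Q i Q∣C) }
    go (no ¬new) _ = record
      { factors = factors ; irreducible = irreducible ; distinct = distinct ; sound = sound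
      ; complete = λ Q i newQ Q∣C → [ (λ e → contradiction (newFactor-cong {Q} {Q₀} (≋.sym e) newQ) ¬new) , complete Q i newQ ]′ (factorOf Q i Q∣C) }

factorList : ∀ n → ¬ ¬ ∃ (FactorList (suc n))
factorList n = ¬¬-map
  (λ fs → let open FactorsIn fs in factors , irreducible , distinct ,
    λ Q m irr → mk⇔ (sound Q (m , irr)) (λ new → complete Q (m , irr) new (∣ₚ⇒∣ₓ {F (suc n)} {Q} (proj₁ new))))
  (factorsIn (suc n) n (F (suc n)) n ℕₚ.≤-refl (F-monic n))

-- Double negation commutes with finite conjunctions only; hence the bound on the indices that
-- receive a list.
¬¬-bounded-∀ : ∀ {P : ℕ → Set} N → (∀ n → ¬ ¬ P n) → ¬ ¬ (∀ n → n < N → P n)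
¬¬-bounded-∀ zero    h k = k λ _ ()
¬¬-bounded-∀ (suc N) h k = ¬¬-bounded-∀ N h λ below → h N λ top → k λ n n<1+N →
  case ℕₚ.m≤n⇒m<n∨m≡n (ℕₚ.≤-pred n<1+N) of λ where
    (inj₁ n<N)  → below n n<N
    (inj₂ refl) → top

FactorLists : ℕ → (ℕ → List Poly) → Set
FactorLists N ψ = ∀ n → 1 ≤ n → n ≤ N → FactorList n (ψ n)

factorLists : ∀ N → ¬ ¬ ∃ (FactorLists N)
factorLists N = ¬¬-map (λ h → choose h , correct h) (¬¬-bounded-∀ N factorList)
  where
  choose : (∀ n → n < N → ∃ (FactorList (suc n))) → ℕ → List Poly
  -- Values outside `1 , … , N` are arbitrary, as `FactorLists N` says nothing about them.
  choose h zero    = []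
  choose h (suc n) with n ℕ.<? N
  ... | yes n<N = proj₁ (h n n<N)
  ... | no _    = []
  correct : ∀ h → FactorLists N (choose h)
  correct h (suc n) _ n≤N with n ℕ.<? N
  ... | yes n<N = proj₂ (h n n<N)
  ... | no n≮N  = contradiction n≤N n≮N

prod-++ : ∀ As Bs → prodₚ (As ++ Bs) ≋ prodₚ As *ₚ prodₚ Bs
prod-++ []       Bs = ≋.sym (≋.*-identityˡ _)
prod-++ (A ∷ As) Bs = ≋.trans (≋.*-congˡ {A} (prod-++ As Bs)) (≋.sym (≋.*-assoc A (prodₚ As) (prodₚ Bs)))

prod-monic : ∀ Qs → All Irr Qs → Monic (prodₚ Qs)
prod-monic []       []       = monic-one
prod-monic (Q ∷ Qs) (i ∷ is) = monic-* {Q} {prodₚ Qs} (proj₁ i) (prod-monic Qs is)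

-- Each product consists of distinct irreducibles that divide the other, so both divisibilities
-- hold. This links the polynomials given in the theorem to the chosen lists.
factorList-unique : ∀ {n As Bs} → FactorList n As → FactorList n Bs → prodₚ As ≋ prodₚ Bs
factorList-unique {n} {As} {Bs} a b = monic-∣-antisym {prodₚ As} {prodₚ Bs}
  (prod-monic As (proj₁ a)) (prod-monic Bs (proj₁ b)) (half a b) (half b a)
  where
  half : ∀ {Cs Ds} → FactorList n Cs → FactorList n Ds → prodₚ Cs ∣ₓ prodₚ Ds
  half {Cs} {Ds} (irrC , distC , newC) (_ , _ , newD) = prod-distinct-∣ Cs irrC distC
    (All.tabulate λ {R} R∈ → let i = All.lookup irrC R∈ in
      ∣-prod Ds (Any.map (λ e → ∣ₓ-respʳ (≋.sym (≈ₚ⇒PolyEq e)) ∣ₓ-refl)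
        (Equivalence.from (newD R (proj₁ i) (proj₂ i))
          (Equivalence.to (newC R (proj₁ i) (proj₂ i)) (Any.map (λ { refl j → refl }) R∈)))))

Π : (ℕ → List Poly) → List ℕ → Poly
Π ψ []       = oneₚ
Π ψ (d ∷ ds) = prodₚ (ψ d) *ₚ Π ψ ds

Π-++ : ∀ ψ ds es → Π ψ (ds ++ es) ≋ Π ψ ds *ₚ Π ψ es
Π-++ ψ []       es = ≋.sym (≋.*-identityˡ _)
Π-++ ψ (d ∷ ds) es = ≋.trans (≋.*-congˡ {prodₚ (ψ d)} (Π-++ ψ ds es)) (≋.sym (≋.*-assoc (prodₚ (ψ d)) (Π ψ ds) (Π ψ es)))

Π-concatMap : ∀ ψ ds → prodₚ (concatMap ψ ds) ≋ Π ψ ds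
Π-concatMap ψ []       = ≋.refl
Π-concatMap ψ (d ∷ ds) = ≋.trans (prod-++ (ψ d) (concatMap ψ ds)) (≋.*-congˡ {prodₚ (ψ d)} (Π-concatMap ψ ds))

-- The order is left free, so that the divisors of `p^(j+1) m` may be listed as those of `p^j m`
-- followed by the remaining ones.
record IsDivisorList (ds : List ℕ) (n : ℕ) : Set where
  field
    unique   : Unique ds
    divisors : ∀ {d} → d ∈ ds → d ℕᵈ.∣ n
    every    : ∀ {d} → d ℕᵈ.∣ n → d ∈ ds

module _ {N ψ} (ψ-lists : FactorLists N ψ) where

  Π-monic : ∀ ds → (∀ {d} → d ∈ ds → 1 ≤ d × d ≤ N) → Monic (Π ψ ds)
  Π-monic []       _ = monic-one
  Π-monic (d ∷ ds) b = monic-* {prodₚ (ψ d)} {Π ψ ds}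
    (prod-monic (ψ d) (proj₁ (ψ-lists d (proj₁ (b (here refl))) (proj₂ (b (here refl)))))) (Π-monic ds (b ∘ there))

  private
    Member : List ℕ → Poly → Set
    Member ds Q = Irr Q × ∃ λ d → d ∈ ds × 1 ≤ d × NewFactor d Q

    listed : ∀ {d} → 1 ≤ d → d ≤ N → ∀ {ds} → d ∈ ds → All (Member ds) (ψ d)
    listed {d} 1≤d d≤N {ds} d∈ = All.tabulate λ {Q} Q∈ →
      let (irr , _ , new) = ψ-lists d 1≤d d≤N
          i = All.lookup irr Q∈
      in i , d , d∈ , 1≤d , Equivalence.to (new Q (proj₁ i) (proj₂ i)) (Any.map (λ { refl j → refl }) Q∈)

    members : ∀ ds → (∀ {d} → d ∈ ds → 1 ≤ d × d ≤ N) → All (Member ds) (concatMap ψ ds)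
    members []       b = []
    members (d ∷ ds) b = All.++⁺ (listed (proj₁ (b (here refl))) (proj₂ (b (here refl))) (here refl))
      (All.map (λ { (i , e , e∈ , r) → i , e , there e∈ , r }) (members ds (b ∘ there)))

    -- Equal factors from two lists would be new at the same index, whereas the indices in `ds`
    -- differ.
    distinct-concatMap : ∀ ds → Unique ds → (∀ {d} → d ∈ ds → 1 ≤ d × d ≤ N) → Distinct (concatMap ψ ds)
    distinct-concatMap []       _          b = []
    distinct-concatMap (d ∷ ds) (d∉ ∷ uds) b = AllPairs.++⁺ (proj₁ (proj₂ (ψ-lists d 1≤d d≤N)))
      (distinct-concatMap ds uds (b ∘ there))
      (All.map (λ { {A} (_ , _ , here refl , _ , newA) → All.map (λ { {B} (_ , e , e∈ , 1≤e , newB) A≈B →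
                     All.lookup d∉ e∈ (newFactor-unique {A} {B} (≈ₚ⇒PolyEq A≈B) 1≤d 1≤e newA newB) }) (members ds (b ∘ there))
                  ; (_ , _ , there () , _) })
        (listed {d} 1≤d d≤N {d ∷ []} (here refl)))
      where
      1≤d = proj₁ (b (here refl))
      d≤N = proj₂ (b (here refl))

    ∣-Π : ∀ {Q d ds} → d ∈ ds → Q ∣ₓ prodₚ (ψ d) → Q ∣ₓ Π ψ ds
    ∣-Π {ds = _ ∷ ds} (here refl) Q∣ = ∣ₓ-m*n (Π ψ ds) Q∣
    ∣-Π {ds = e ∷ ds} (there d∈)  Q∣ = ∣ₓ-n*m (prodₚ (ψ e)) (∣-Π d∈ Q∣)

  private
    Bounded : List ℕ → Set
    Bounded ds = ∀ {d} → d ∈ ds → 1 ≤ d × d ≤ N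

    Π∣F : ∀ n {ds} → Bounded ds → IsDivisorList ds n → Π ψ ds ∣ₓ F n
    Π∣F n {ds} bound isDiv = ∣ₓ-respˡ (Π-concatMap ψ ds) (prod-distinct-∣ (concatMap ψ ds) (All.map proj₁ mem)
      (distinct-concatMap ds unique bound)
      (All.map (λ { {Q} (_ , d , d∈ , _ , new) → ∣ₓ-trans (∣ₚ⇒∣ₓ {F d} {Q} (proj₁ new)) (F-∣ (divisors d∈)) }) mem))
      where
      open IsDivisorList isDiv
      mem = members ds bound

    newFactor-∣-Π : ∀ {e Q ds} → 1 ≤ e → e ≤ N → e ∈ ds → Irr Q → NewFactor e Q → Q ∣ₓ Π ψ ds
    newFactor-∣-Π {e} {Q} 1≤e e≤N e∈ds i new = ∣-Π e∈ds (∣-prod (ψ e)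
      (Any.map (λ f → ∣ₓ-respʳ (≋.sym (≈ₚ⇒PolyEq f)) ∣ₓ-refl)
        (Equivalence.from (proj₂ (proj₂ (ψ-lists e 1≤e e≤N)) Q (proj₁ i) (proj₂ i)) new)))

    -- An irreducible factor of the cofactor C already divides Π ψ ds, against squarefreeness.
    cofactor-irr-∤ : ∀ n {ds C Q} → suc n ≤ N → IsDivisorList ds (suc n) → F (suc n) ≋ Π ψ ds *ₚ C → Irr Q → ¬ Q ∣ₓ C
    cofactor-irr-∤ n {ds} {C} {Q} n<N isDiv F≋ΠC i Q∣C =
      [ found , (λ none → none (suc n) (s≤s z≤n) ℕₚ.≤-refl (∣ₓ⇒∣ₚ Q∣F)) ]′ (firstIndex {Q} (proj₁ i) (suc n))
      where
      open IsDivisorList isDiv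
      Q∣F : Q ∣ₓ F (suc n)
      Q∣F = ∣ₓ-respʳ (≋.sym F≋ΠC) (∣ₓ-n*m (Π ψ ds) Q∣C)
      lem : ∀ Q S T → Q *ₚ S *ₚ (Q *ₚ T) ≋ Q *ₚ Q *ₚ (S *ₚ T)
      lem = solve-∀ ℤ[x]
      QQ∣ : ∀ {A B} → Q ∣ₓ A → Q ∣ₓ B → Q *ₚ Q ∣ₓ A *ₚ B
      QQ∣ (dividesₓ S e) (dividesₓ T f) = dividesₓ (S *ₚ T) (≋.trans (≋.*-cong e f) (lem Q S T))
      found : (∃ λ e → 1 ≤ e × e ≤ suc n × NewFactor e Q) → ⊥
      found (e , 1≤e , e≤n , new) = F-squarefree {Q} i n (∣ₓ-respʳ (≋.sym F≋ΠC) (QQ∣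
        (newFactor-∣-Π 1≤e (ℕₚ.≤-trans e≤n n<N) (every (newFactor-∣ {Q} i new 1≤e (suc n) (suc n) ℕₚ.≤-refl Q∣F)) i new) Q∣C))

  -- The product divides `F n`, being made of distinct irreducibles that do. Its cofactor is monic
  -- without irreducible factors, hence 1: a positive degree would provide such a factor up to
  -- double negation, enough for a contradiction.
  F≋Π : ∀ {n ds} → 1 ≤ n → n ≤ N → IsDivisorList ds n → F n ≋ Π ψ ds
  F≋Π {suc n} {ds} 1≤n n≤N isDiv = cofactor-one (Π∣F (suc n) bound isDiv)
    where
    open IsDivisorList isDiv
    bound : Bounded ds
    bound d∈ = ℕₚ.n≢0⇒n>0 (λ { refl → case ℕᵈ.0∣⇒≡0 (divisors d∈) of λ () }) , ℕₚ.≤-trans (ℕᵈ.∣⇒≤ (divisors d∈)) n≤N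
    degree-0 : ∀ {C} → F (suc n) ≋ Π ψ ds *ₚ C → Monic C → C ≋ oneₚ
    degree-0 {C} F≋ΠC (zero  , m) = degree-0⇒one {C} m
    degree-0 {C} F≋ΠC (suc c , m) = ⊥-elim (irreducibleFactor (suc c) C (suc c) ℕₚ.≤-refl (s≤s z≤n) m
      λ { (Q , i , Q∣C) → cofactor-irr-∤ n n≤N isDiv F≋ΠC i Q∣C })
    cofactor-one : Π ψ ds ∣ₓ F (suc n) → F (suc n) ≋ Π ψ ds
    cofactor-one (dividesₓ C F≋ΠC) = ≋.trans F≋ΠC (≋.trans (≋.*-congˡ {Π ψ ds}
      (degree-0 F≋ΠC (monic-cofactor (F (suc n)) (Π ψ ds) C (n , F-monic n) (Π-monic ds bound) F≋ΠC)))
      (≋.*-identityʳ (Π ψ ds)))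

-- Fibonacci polynomials modulo a prime

-- binom a b j i is the coefficient of Sⁱ in (a S + b)ʲ. With a = Fₙ, b = Fₙ₋₁ and S the shift of
-- the index, a S + b shifts Fibonacci polynomials by n.
binom : Poly → Poly → ℕ → ℕ → Poly
binom a b zero    zero    = oneₚ
binom a b zero    (suc i) = []
binom a b (suc j) zero    = b *ₚ binom a b j zero
binom a b (suc j) (suc i) = a *ₚ binom a b j i +ₚ b *ₚ binom a b j (suc i)

-- The derivative of (a S + b)ʲ⁺¹ is (j+1) a (a S + b)ʲ.
binom-absorption : ∀ a b j i → const (+ suc i) *ₚ binom a b (suc j) (suc i) ≋ const (+ suc j) *ₚ (a *ₚ binom a b j i)
binom-absorption a b zero zero = ≋.*-congˡ {oneₚ} (≋.trans (≋.+-congˡ {a *ₚ oneₚ} (≋.zeroʳ b)) (≋.+-identityʳ _))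
binom-absorption a b zero (suc i) = ≋.trans
  (≋.trans (≋.*-congˡ {ν} (≋.+-cong {y = []} (≋.zeroʳ a) (≋.zeroʳ b))) (≋.zeroʳ ν))
  (≋.sym (≋.trans (≋.*-congˡ {oneₚ} (≋.zeroʳ a)) (≋.zeroʳ oneₚ)))
  where ν = const (+ suc (suc i))
binom-absorption a b (suc j) zero = begin
  const (+ 1) *ₚ (a *ₚ (b *ₚ v) +ₚ b *ₚ w)
    ≈⟨ lem₁ a b v w ⟩
  a *ₚ (b *ₚ v) +ₚ b *ₚ (const (+ 1) *ₚ w)
    ≈⟨ ≋.+-congˡ {a *ₚ (b *ₚ v)} (≋.*-congˡ {b} (binom-absorption a b j zero)) ⟩
  a *ₚ (b *ₚ v) +ₚ b *ₚ (ν *ₚ (a *ₚ v))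
    ≈⟨ lem₂ a b v ν ⟩
  (oneₚ +ₚ ν) *ₚ (a *ₚ (b *ₚ v)) ∎
  where
  open ≋-Reasoning
  ν = const (+ suc j)
  v = binom a b j zero
  w = binom a b (suc j) 1
  lem₁ : ∀ a b v w → const (+ 1) *ₚ (a *ₚ (b *ₚ v) +ₚ b *ₚ w) ≋ a *ₚ (b *ₚ v) +ₚ b *ₚ (const (+ 1) *ₚ w)
  lem₁ = solve-∀ ℤ[x]
  lem₂ : ∀ a b v ν → a *ₚ (b *ₚ v) +ₚ b *ₚ (ν *ₚ (a *ₚ v)) ≋ (oneₚ +ₚ ν) *ₚ (a *ₚ (b *ₚ v))
  lem₂ = solve-∀ ℤ[x]
binom-absorption a b (suc j) (suc i) = begin
  (oneₚ +ₚ μ) *ₚ (a *ₚ w +ₚ b *ₚ z)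
    ≈⟨ lem₁ a b w z μ ⟩
  a *ₚ w +ₚ a *ₚ (μ *ₚ w) +ₚ b *ₚ ((oneₚ +ₚ μ) *ₚ z)
    ≈⟨ ≋.+-cong (≋.+-congˡ {a *ₚ w} (≋.*-congˡ {a} (binom-absorption a b j i))) (≋.*-congˡ {b} (binom-absorption a b j (suc i))) ⟩
  a *ₚ (a *ₚ u +ₚ b *ₚ v) +ₚ a *ₚ (ν *ₚ (a *ₚ u)) +ₚ b *ₚ (ν *ₚ (a *ₚ v))
    ≈⟨ lem₂ a b u v ν ⟩
  (oneₚ +ₚ ν) *ₚ (a *ₚ w) ∎
  where
  open ≋-Reasoning
  μ = const (+ suc i)
  ν = const (+ suc j)
  u = binom a b j i
  v = binom a b j (suc i)
  w = binom a b (suc j) (suc i)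
  z = binom a b (suc j) (suc (suc i))
  lem₁ : ∀ a b w z μ → (oneₚ +ₚ μ) *ₚ (a *ₚ w +ₚ b *ₚ z) ≋ a *ₚ w +ₚ a *ₚ (μ *ₚ w) +ₚ b *ₚ ((oneₚ +ₚ μ) *ₚ z)
  lem₁ = solve-∀ ℤ[x]
  lem₂ : ∀ a b u v ν → a *ₚ (a *ₚ u +ₚ b *ₚ v) +ₚ a *ₚ (ν *ₚ (a *ₚ u)) +ₚ b *ₚ (ν *ₚ (a *ₚ v))
    ≋ (oneₚ +ₚ ν) *ₚ (a *ₚ (a *ₚ u +ₚ b *ₚ v))
  lem₂ = solve-∀ ℤ[x]

binom-above : ∀ a b j i → j < i → binom a b j i ≋ []
binom-above a b zero    (suc i) _         = ≋.refl
binom-above a b (suc j) (suc i) (s≤s j<i) = ≋.+-cong {y = []}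
  (≋.trans (≋.*-congˡ {a} (binom-above a b j i j<i)) (≋.zeroʳ a))
  (≋.trans (≋.*-congˡ {b} (binom-above a b j (suc i) (ℕₚ.m≤n⇒m≤1+n j<i))) (≋.zeroʳ b))

binom-diagonal : ∀ a b j → binom a b j j ≋ a ^ₚ j
binom-diagonal a b zero    = ≋.refl
binom-diagonal a b (suc j) = ≋.trans (≋.+-cong (≋.*-congˡ {a} (binom-diagonal a b j))
    (≋.trans (≋.*-congˡ {b} (binom-above a b j (suc j) ℕₚ.≤-refl)) (≋.zeroʳ b)))
  (≋.+-identityʳ _)

Σₚ : ℕ → (ℕ → Poly) → Poly
Σₚ zero    f = []
Σₚ (suc n) f = Σₚ n f +ₚ f n

Σₚ-cong : ∀ {q} n {f g} → (∀ i → i < n → PolyEq q (f i) (g i)) → PolyEq q (Σₚ n f) (Σₚ n g)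
Σₚ-cong zero    h = polyRefl
Σₚ-cong (suc n) h = +ₚ-cong (Σₚ-cong n λ i i<n → h i (ℕₚ.m≤n⇒m≤1+n i<n)) (h n ℕₚ.≤-refl)

Σₚ-zero : ∀ {q} n {f} → (∀ i → i < n → PolyEq q (f i) []) → PolyEq q (Σₚ n f) []
Σₚ-zero zero    h = polyRefl
Σₚ-zero (suc n) h = +ₚ-cong {Q′ = []} (Σₚ-zero n λ i i<n → h i (ℕₚ.m≤n⇒m≤1+n i<n)) (h n ℕₚ.≤-refl)

-- The effect of one more factor `a S + b`: `a` meets the values of `h` shifted by one index and `b`
-- the unshifted ones.
Σₚ-binom-suc : ∀ a b j (h : ℕ → Poly) n → Σₚ (suc n) (λ i → binom a b (suc j) i *ₚ h i) ≋
  a *ₚ Σₚ n (λ i → binom a b j i *ₚ h (suc i)) +ₚ b *ₚ Σₚ (suc n) (λ i → binom a b j i *ₚ h i)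
Σₚ-binom-suc a b j h zero = ≋.sym (≋.+-cong {y = []} (≋.zeroʳ a) (≋.sym (≋.*-assoc b (binom a b j 0) (h 0))))
Σₚ-binom-suc a b j h (suc n) = ≋.trans (≋.+-congʳ {binom a b (suc j) (suc n) *ₚ h (suc n)} (Σₚ-binom-suc a b j h n))
  (lem a b (Σₚ n λ i → binom a b j i *ₚ h (suc i)) (Σₚ (suc n) λ i → binom a b j i *ₚ h i) (binom a b j n) (binom a b j (suc n)) (h (suc n)))
  where lem : ∀ a b S T u v h → a *ₚ S +ₚ b *ₚ T +ₚ (a *ₚ u +ₚ b *ₚ v) *ₚ h ≋ a *ₚ (S +ₚ u *ₚ h) +ₚ b *ₚ (T +ₚ v *ₚ h)
        lem = solve-∀ ℤ[x]

-- By the addition formula, raising the index by `n+1` acts as `a S + b`; this is its j-th power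
-- evaluated at `t`. The induction needs `t` free, as it passes to `t + 1`.
F-binomial : ∀ n j t → F (j ℕ.* suc n ℕ.+ t) ≋ Σₚ (suc j) (λ i → binom (F (suc n)) (F n) j i *ₚ F (i ℕ.+ t))
F-binomial n zero    t = ≋.sym (≋.*-identityˡ (F t))
F-binomial n (suc j) t = begin
  F (suc n ℕ.+ j ℕ.* suc n ℕ.+ t)
    ≡⟨ cong F (ℕₚ.+-assoc (suc n) (j ℕ.* suc n) t) ⟩
  F (suc n ℕ.+ (j ℕ.* suc n ℕ.+ t))
    ≈⟨ F-+ n (j ℕ.* suc n ℕ.+ t) ⟩
  a *ₚ F (suc (j ℕ.* suc n ℕ.+ t)) +ₚ b *ₚ F (j ℕ.* suc n ℕ.+ t)
    ≡⟨ cong (λ s → a *ₚ F s +ₚ b *ₚ F (j ℕ.* suc n ℕ.+ t)) (ℕₚ.+-suc (j ℕ.* suc n) t) ⟨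
  a *ₚ F (j ℕ.* suc n ℕ.+ suc t) +ₚ b *ₚ F (j ℕ.* suc n ℕ.+ t)
    ≈⟨ ≋.+-cong (≋.*-congˡ {a} (≋.trans (F-binomial n j (suc t)) reindex))
         (≋.*-congˡ {b} (≋.trans (F-binomial n j t) (≋.sym top))) ⟩
  a *ₚ Σₚ (suc j) (λ i → binom a b j i *ₚ F (suc i ℕ.+ t)) +ₚ b *ₚ Σₚ (suc (suc j)) (λ i → binom a b j i *ₚ F (i ℕ.+ t))
    ≈⟨ Σₚ-binom-suc a b j (λ i → F (i ℕ.+ t)) (suc j) ⟨
  Σₚ (suc (suc j)) (λ i → binom a b (suc j) i *ₚ F (i ℕ.+ t)) ∎
  where
  open ≋-Reasoning
  a = F (suc n)
  b = F n
  reindex : Σₚ (suc j) (λ i → binom a b j i *ₚ F (i ℕ.+ suc t)) ≋ Σₚ (suc j) (λ i → binom a b j i *ₚ F (suc i ℕ.+ t))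
  reindex = Σₚ-cong (suc j) λ i _ → ≋.reflexive (cong (λ s → binom a b j i *ₚ F s) (ℕₚ.+-suc i t))
  top : Σₚ (suc (suc j)) (λ i → binom a b j i *ₚ F (i ℕ.+ t)) ≋ Σₚ (suc j) (λ i → binom a b j i *ₚ F (i ℕ.+ t))
  top = ≋.trans (≋.+-congˡ {Σₚ (suc j) _} (≋.*-congʳ {F (suc j ℕ.+ t)} (binom-above a b j (suc j) ℕₚ.≤-refl))) (≋.+-identityʳ _)

-- By absorption, `(i+1)` times the coefficient is a multiple of `p`, and `0 < i+1 < p` is not a
-- zero divisor modulo `p`.
binom≈0 : ∀ {p} → Prime p → ∀ a b i → suc i < p → PolyEq p (binom a b p (suc i)) []
binom≈0 {p@(suc p-1)} pr a b i 1+i<p =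
  [ (λ e → contradiction e i≉0) , (λ e → e) ]′
    (*ₚ≈0 (prime⇒noZeroDivisors pr) (const (+ suc i)) (binom a b p (suc i))
      (polyTrans (reduce (binom-absorption a b p-1 i)) (const∣⇒≈0 p (a *ₚ binom a b p-1 i))))
  where
  i≉0 : ¬ PolyEq p (const (+ suc i)) []
  i≉0 e = ℕₚ.<⇒≱ 1+i<p (ℕᵈ.∣⇒≤ (∣⇒∣ᵤ (ModEq0⇒∣ (at e 0))))

F-prime* : ∀ {p} → Prime p → ∀ n → 1 ≤ n → PolyEq p (F (p ℕ.* n)) (F n ^ₚ p *ₚ F p)
F-prime* {p} pr (suc n) _ = begin
  F (p ℕ.* suc n)                            ≡⟨ cong F (ℕₚ.+-identityʳ (p ℕ.* suc n)) ⟨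
  F (p ℕ.* suc n ℕ.+ 0)                      ≈⟨ reduce (F-binomial n p 0) ⟩
  Σₚ p f +ₚ f p                              ≈⟨ +ₚ-cong (Σₚ-zero p vanish) (reduce last) ⟩
  F (suc n) ^ₚ p *ₚ F p                      ∎
  where
  open SetoidReasoning (polySetoid {p})
  f : ℕ → Poly
  f i = binom (F (suc n)) (F n) p i *ₚ F (i ℕ.+ 0)
  vanish : ∀ i → i < p → PolyEq p (f i) []
  -- The coefficient here is `(F n)^p`; the term vanishes because `F 0 = 0`.
  vanish zero    _   = *ₚ-zeroʳ (binom (F (suc n)) (F n) p 0)
  vanish (suc i) i<p = *ₚ-zeroˡ (binom (F (suc n)) (F n) p (suc i)) (binom≈0 pr (F (suc n)) (F n) i i<p)
  last : f p ≋ F (suc n) ^ₚ p *ₚ F p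
  last = ≋.*-cong (binom-diagonal (F (suc n)) (F n) p) (≋.reflexive (cong F (ℕₚ.+-identityʳ p)))

^ₚ-+ : ∀ P m n → P ^ₚ (m ℕ.+ n) ≋ P ^ₚ m *ₚ P ^ₚ n
^ₚ-+ P zero    n = ≋.sym (≋.*-identityˡ _)
^ₚ-+ P (suc m) n = ≋.trans (≋.*-congˡ {P} (^ₚ-+ P m n)) (≋.sym (≋.*-assoc P (P ^ₚ m) (P ^ₚ n)))

^ₚ-* : ∀ P m n → P ^ₚ (m ℕ.* n) ≋ (P ^ₚ n) ^ₚ m
^ₚ-* P zero    n = ≋.refl
^ₚ-* P (suc m) n = ≋.trans (^ₚ-+ P n (m ℕ.* n)) (≋.*-congˡ {P ^ₚ n} (^ₚ-* P m n))

*ₚ-^ₚ : ∀ P Q n → (P *ₚ Q) ^ₚ n ≋ P ^ₚ n *ₚ Q ^ₚ n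
*ₚ-^ₚ P Q zero    = ≋.sym (≋.*-identityˡ oneₚ)
*ₚ-^ₚ P Q (suc n) = ≋.trans (≋.*-congˡ {P *ₚ Q} (*ₚ-^ₚ P Q n)) (lem P Q (P ^ₚ n) (Q ^ₚ n))
  where lem : ∀ P Q A B → P *ₚ Q *ₚ (A *ₚ B) ≋ P *ₚ A *ₚ (Q *ₚ B)
        lem = solve-∀ ℤ[x]

^ₚ-cong : ∀ {q P Q} n → PolyEq q P Q → PolyEq q (P ^ₚ n) (Q ^ₚ n)
^ₚ-cong zero            e = polyRefl
^ₚ-cong {q} {P} {Q} (suc n) e = polyTrans (*ₚ-congʳ P Q e) (*ₚ-congˡ Q (^ₚ-cong n e))

one-^ₚ : ∀ n → oneₚ ^ₚ n ≋ oneₚ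
one-^ₚ zero    = ≋.refl
one-^ₚ (suc n) = ≋.trans (≋.*-identityˡ _) (one-^ₚ n)

^ₚ-monic : ∀ P n → Monic P → Monic (P ^ₚ n)
^ₚ-monic P zero    m = monic-one
^ₚ-monic P (suc n) m = monic-* {P} {P ^ₚ n} m (^ₚ-monic P n m)

prime∤1 : ∀ {p} → Prime p → ¬ p ℕᵈ.∣ 1
prime∤1 pr p∣1 = ℕ.nonTrivial⇒≢1 {{prime⇒nonTrivial pr}} (ℕᵈ.∣1⇒≡1 p∣1)

monic≉0-mod : ∀ {p P} → Prime p → Monic P → ¬ PolyEq p P []
monic≉0-mod {p} {P} pr (d , c , _) e = prime∤1 pr (∣⇒∣ᵤ (ModEq0⇒∣ (subst (λ a → ModEq p a (+ 0)) c (at e d))))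

m^n>0 : ∀ {p} → Prime p → ∀ k → 1 ≤ p ℕ.^ k
m^n>0 {p} pr k = ℕₚ.m^n>0 p {{prime⇒nonZero pr}} k

-- Iterates the previous congruence, which is used again at `n = p^k` to fold `(F n)^p · F p` back
-- into `F (p n)`.
F-prime^* : ∀ {p} → Prime p → ∀ k m → 1 ≤ m → PolyEq p (F (p ℕ.^ k ℕ.* m)) (F (p ℕ.^ k) *ₚ F m ^ₚ (p ℕ.^ k))
F-prime^* {p} pr zero    m 1≤m = reduce (≋.trans (≋.reflexive (cong F (ℕₚ.*-identityˡ m)))
  (≋.sym (≋.trans (≋.*-identityˡ _) (≋.*-identityʳ (F m)))))
F-prime^* {p} pr (suc k) m 1≤m = begin
  F (p ℕ.* r ℕ.* m)                          ≡⟨ cong F (ℕₚ.*-assoc p r m) ⟩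
  F (p ℕ.* (r ℕ.* m))                        ≈⟨ F-prime* pr (r ℕ.* m) (ℕₚ.*-mono-≤ (m^n>0 pr k) 1≤m) ⟩
  F (r ℕ.* m) ^ₚ p *ₚ F p                    ≈⟨ P.*-congʳ {F p} (^ₚ-cong p (F-prime^* pr k m 1≤m)) ⟩
  (F r *ₚ F m ^ₚ r) ^ₚ p *ₚ F p              ≈⟨ reduce (≋.*-congʳ {F p} (*ₚ-^ₚ (F r) (F m ^ₚ r) p)) ⟩
  F r ^ₚ p *ₚ (F m ^ₚ r) ^ₚ p *ₚ F p         ≈⟨ reduce (lem (F r ^ₚ p) ((F m ^ₚ r) ^ₚ p) (F p)) ⟩
  F r ^ₚ p *ₚ F p *ₚ (F m ^ₚ r) ^ₚ p         ≈⟨ P.*-cong (F-prime* pr r (m^n>0 pr k)) (reduce (^ₚ-* (F m) p r)) ⟨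
  F (p ℕ.* r) *ₚ F m ^ₚ (p ℕ.* r)            ∎
  where
  module P = CommutativeRing (polyRing p)
  open SetoidReasoning (polySetoid {p})
  r = p ℕ.^ k
  lem : ∀ A B C → A *ₚ B *ₚ C ≋ A *ₚ C *ₚ B
  lem = solve-∀ ℤ[x]

-- Divisors

-- The divisor 1 is left out as well as `n`: these are the indices to which the induction hypothesis
-- applies.
properDivisors : ℕ → List ℕ
properDivisors n = filter (ℕᵈ._∣? n) (applyUpTo (2 ℕ.+_) (n ℕ.∸ 2))

properDivisors-∈ : ∀ {d n} → d ∈ properDivisors n → 2 ≤ d × d < n × d ℕᵈ.∣ n
properDivisors-∈ {d} {n} d∈ with ∈-filter⁻ (ℕᵈ._∣? n) {xs = applyUpTo (2 ℕ.+_) (n ℕ.∸ 2)} d∈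
... | d∈′ , d∣n with ∈-applyUpTo⁻ (2 ℕ.+_) d∈′
...   | i , i<n-2 , refl = s≤s (s≤s z≤n) , lemma n i<n-2 , d∣n
  where
  lemma : ∀ n → i < n ℕ.∸ 2 → 2 ℕ.+ i < n
  lemma (suc (suc n)) l = s≤s (s≤s l)

∈-properDivisors : ∀ {d n} → 2 ≤ d → d < n → d ℕᵈ.∣ n → d ∈ properDivisors n
∈-properDivisors {suc (suc i)} {suc (suc n)} (s≤s (s≤s _)) (s≤s (s≤s i<n)) d∣n =
  ∈-filter⁺ (ℕᵈ._∣? _) (∈-applyUpTo⁺ (2 ℕ.+_) i<n) d∣n

-- At 1 the general list would contain 1 twice.
divisorsOf : ℕ → List ℕ
divisorsOf 1 = 1 ∷ []
divisorsOf n = n ∷ 1 ∷ properDivisors n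

isDivisorList-1 : IsDivisorList (1 ∷ []) 1
isDivisorList-1 = record
  { unique = [] ∷ [] ; divisors = λ { (here refl) → ℕᵈ.∣-refl } ; every = here ∘ ℕᵈ.∣1⇒≡1 }

isDivisorList-≥2 : ∀ {n} → 2 ≤ n → IsDivisorList (n ∷ 1 ∷ properDivisors n) n
isDivisorList-≥2 {n} 2≤n = record
  { unique = ((λ n≡1 → ℕₚ.<⇒≢ 2≤n (≡.sym n≡1)) ∷ All.tabulate λ d∈ n≡d → ℕₚ.<⇒≢ (proj₁ (proj₂ (properDivisors-∈ d∈))) (≡.sym n≡d))
           ∷ All.tabulate (λ d∈ 1≡d → ℕₚ.<⇒≢ (proj₁ (properDivisors-∈ {n = n} d∈)) 1≡d)
           ∷ Unique.filter⁺ (ℕᵈ._∣? n) (Unique.applyUpTo⁺₁ (2 ℕ.+_) (n ℕ.∸ 2) λ i<j _ e → ℕₚ.<⇒≢ i<j (ℕₚ.+-cancelˡ-≡ 2 _ _ e))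
  ; divisors = λ { (here refl) → ℕᵈ.∣-refl ; (there (here refl)) → ℕᵈ.1∣ n
                 ; (there (there d∈)) → proj₂ (proj₂ (properDivisors-∈ d∈)) }
  ; every = every 2≤n }
  where
  every : ∀ {n} → 2 ≤ n → ∀ {d} → d ℕᵈ.∣ n → d ∈ n ∷ 1 ∷ properDivisors n
  every 2≤n {zero} d∣n with ℕᵈ.0∣⇒≡0 d∣n
  every () {zero} d∣n | refl
  every 2≤n {suc zero} d∣n = there (here refl)
  every {n@(suc _)} 2≤n {d@(suc (suc _))} d∣n with ℕₚ.m≤n⇒m<n∨m≡n (ℕᵈ.∣⇒≤ d∣n)
  ... | inj₁ d<n = there (there (∈-properDivisors (s≤s (s≤s z≤n)) d<n d∣n))
  ... | inj₂ d≡n = here d≡n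

isDivisorList : ∀ n → 1 ≤ n → IsDivisorList (divisorsOf n) n
isDivisorList 1             _ = isDivisorList-1
isDivisorList (suc (suc n)) _ = isDivisorList-≥2 (s≤s (s≤s z≤n))

-- In `p n = c x` the prime divides `c` or `x` and is cancelled there.
∣-prime* : ∀ {p} → Prime p → ∀ {x n} → x ℕᵈ.∣ p ℕ.* n → x ℕᵈ.∣ n ⊎ (∃ λ y → x ≡ p ℕ.* y × y ℕᵈ.∣ n)
∣-prime* {p} pr {x} {n} (ℕᵈ.divides c pn≡cx) with euclidsLemma c x pr (ℕᵈ.divides n (≡.trans (≡.sym pn≡cx) (ℕₚ.*-comm p n)))
... | inj₁ (ℕᵈ.divides c′ refl) = inj₁ (ℕᵈ.divides c′ (ℕₚ.*-cancelˡ-≡ n (c′ ℕ.* x) p {{prime⇒nonZero pr}}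
        (≡.trans pn≡cx (≡.trans (cong (ℕ._* x) (ℕₚ.*-comm c′ p)) (ℕₚ.*-assoc p c′ x)))))
... | inj₂ (ℕᵈ.divides y refl)  = inj₂ (y , ℕₚ.*-comm y p , ℕᵈ.divides c (ℕₚ.*-cancelˡ-≡ n (c ℕ.* y) p {{prime⇒nonZero pr}}
        (≡.trans pn≡cx (≡.trans (≡.sym (ℕₚ.*-assoc c y p)) (ℕₚ.*-comm (c ℕ.* y) p)))))

∣-prime^* : ∀ {p} → Prime p → ∀ j {x m} → x ℕᵈ.∣ p ℕ.^ suc j ℕ.* m →
  x ℕᵈ.∣ p ℕ.^ j ℕ.* m ⊎ (∃ λ d → x ≡ p ℕ.^ suc j ℕ.* d × d ℕᵈ.∣ m)
∣-prime^* {p} pr j {x} {m} x∣ with ∣-prime* pr (subst (x ℕᵈ.∣_) (ℕₚ.*-assoc p (p ℕ.^ j) m) x∣)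
... | inj₁ x∣′ = inj₁ x∣′
∣-prime^* {p} pr zero    {x} {m} x∣ | inj₂ (y , refl , y∣) =
  inj₂ (y , cong (ℕ._* y) (≡.sym (ℕₚ.*-identityʳ p)) , subst (y ℕᵈ.∣_) (ℕₚ.*-identityˡ m) y∣)
∣-prime^* {p} pr (suc j) {x} {m} x∣ | inj₂ (y , refl , y∣) with ∣-prime^* pr j y∣
... | inj₁ y∣′              = inj₁ (subst (p ℕ.* y ℕᵈ.∣_) (≡.sym (ℕₚ.*-assoc p (p ℕ.^ j) m)) (ℕᵈ.*-monoʳ-∣ p y∣′))
... | inj₂ (d , refl , d∣m) = inj₂ (d , ≡.sym (ℕₚ.*-assoc p (p ℕ.^ suc j) d) , d∣m)

-- The two parts are disjoint because `p^(j+1) e ∣ p^j m` would give `p ∣ m`.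
isDivisorList-prime^* : ∀ {p} → Prime p → ∀ j {m ds es} → ¬ p ℕᵈ.∣ m →
  IsDivisorList ds (p ℕ.^ j ℕ.* m) → IsDivisorList es m →
  IsDivisorList (ds ++ map (p ℕ.^ suc j ℕ.*_) es) (p ℕ.^ suc j ℕ.* m)
isDivisorList-prime^* {p} pr j {m} {ds} {es} p∤m D E = record
  { unique = Unique.++⁺ Ds.unique (Unique.map⁺ (ℕₚ.*-cancelˡ-≡ _ _ s {{s≢0}}) Es.unique) disjoint
  ; divisors = λ d∈ → [ (λ d∈ds → ℕᵈ.∣-trans (Ds.divisors d∈ds) (subst (r ℕ.* m ℕᵈ.∣_) (≡.sym (ℕₚ.*-assoc p r m)) (ℕᵈ.n∣m*n p)))
                      , (λ d∈es → let (e , e∈ , d≡) = ∈-map⁻ (s ℕ.*_) d∈es in subst (ℕᵈ._∣ s ℕ.* m) (≡.sym d≡) (ℕᵈ.*-monoʳ-∣ s (Es.divisors e∈))) ]′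
                      (∈-++⁻ ds d∈)
  ; every = λ {d} d∣ → [ (λ d∣′ → ∈-++⁺ˡ (Ds.every d∣′))
                   , (λ { (e , refl , e∣m) → ∈-++⁺ʳ ds (∈-map⁺ (s ℕ.*_) (Es.every e∣m)) }) ]′ (∣-prime^* pr j d∣) }
  where
  module Ds = IsDivisorList D
  module Es = IsDivisorList E
  r = p ℕ.^ j
  s = p ℕ.^ suc j
  r≢0 : NonZero r
  r≢0 = ℕₚ.m^n≢0 p j {{prime⇒nonZero pr}}
  s≢0 : NonZero s
  s≢0 = ℕₚ.m^n≢0 p (suc j) {{prime⇒nonZero pr}}
  disjoint : ∀ {x} → ¬ (x ∈ ds × x ∈ map (s ℕ.*_) es)
  disjoint (x∈ds , x∈es) with ∈-map⁻ (s ℕ.*_) x∈es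
  ... | e , _ , refl = p∤m (ℕᵈ.*-cancelˡ-∣ r {{r≢0}} (subst (ℕᵈ._∣ r ℕ.* m) (ℕₚ.*-comm p r) (ℕᵈ.m*n∣⇒m∣ (p ℕ.* r) e (Ds.divisors x∈ds))))

-- Euler's totient at prime powers

∣-prime^⇒≡1 : ∀ {p} → Prime p → ∀ k {x} → ¬ p ℕᵈ.∣ x → x ℕᵈ.∣ p ℕ.^ k → x ≡ 1
∣-prime^⇒≡1 pr zero    p∤x x∣ = ℕᵈ.∣1⇒≡1 x∣
∣-prime^⇒≡1 pr (suc k) p∤x x∣ with ∣-prime* pr x∣
... | inj₁ x∣′            = ∣-prime^⇒≡1 pr k p∤x x∣′
... | inj₂ (y , refl , _) = contradiction (ℕᵈ.m∣m*n y) p∤x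

module _ {p-1 : ℕ} (pr : Prime (suc p-1)) (j : ℕ) where
  private
    p = suc p-1
    s = p ℕ.^ suc j
    coprime? = λ i → gcd i s ℕ.≟ 1
    count : ℕ → ℕ
    count n = length (filter coprime? (applyUpTo suc n))

    count-suc : ∀ n → count (suc n) ≡ count n ℕ.+ length (filter coprime? (suc n ∷ []))
    count-suc n = begin
      length (filter coprime? (applyUpTo suc (suc n)))
        ≡⟨ cong (length ∘ filter coprime?) (applyUpTo-∷ʳ suc n) ⟨
      length (filter coprime? (applyUpTo suc n ++ suc n ∷ []))
        ≡⟨ cong length (filter-++ coprime? (applyUpTo suc n) (suc n ∷ [])) ⟩
      length (filter coprime? (applyUpTo suc n) ++ filter coprime? (suc n ∷ []))
        ≡⟨ length-++ (filter coprime? (applyUpTo suc n)) ⟩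
      count n ℕ.+ length (filter coprime? (suc n ∷ [])) ∎
      where open ≡.≡-Reasoning

    count-coprime : ∀ n → ¬ p ℕᵈ.∣ suc n → count (suc n) ≡ suc (count n)
    count-coprime n p∤ = ≡.trans (count-suc n) (≡.trans
      (cong (λ l → count n ℕ.+ length l) (filter-accept coprime? {suc n} {[]} (∣-prime^⇒≡1 pr (suc j)
        (λ p∣g → p∤ (ℕᵈ.∣-trans p∣g (gcd[m,n]∣m (suc n) s))) (gcd[m,n]∣n (suc n) s))))
      (ℕₚ.+-comm (count n) 1))

    count-multiple : ∀ n → p ℕᵈ.∣ suc n → count (suc n) ≡ count n
    count-multiple n p∣ = ≡.trans (count-suc n) (≡.trans
      (cong (λ l → count n ℕ.+ length l) (filter-reject coprime? {suc n} {[]}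
        (λ g≡1 → prime∤1 pr (subst (p ℕᵈ.∣_) g≡1 (gcd-greatest p∣ (ℕᵈ.m∣m*n (p ℕ.^ j)))))))
      (ℕₚ.+-identityʳ _))

    -- The numbers up to `q p + i` not coprime to `p^(j+1)` are the multiples of `p`, and there are
    -- `q` of them as long as `i < p`.
    count-+ : ∀ q i → i < p → count (q ℕ.* p ℕ.+ i) ℕ.+ q ≡ q ℕ.* p ℕ.+ i
    count-+ zero    zero    _   = refl
    -- Crossing a block boundary: `(q+1) p` is the successor of `q p + (p-1)` and is itself a
    -- multiple of `p`.
    count-+ (suc q) zero    _   = begin
      count (p ℕ.+ q ℕ.* p ℕ.+ 0) ℕ.+ suc q     ≡⟨ cong (λ n → count n ℕ.+ suc q) shift ⟩
      count (suc (q ℕ.* p ℕ.+ p-1)) ℕ.+ suc q   ≡⟨ cong (ℕ._+ suc q) (count-multiple _ (subst (p ℕᵈ.∣_) shift′ (ℕᵈ.n∣m*n (suc q)))) ⟩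
      count (q ℕ.* p ℕ.+ p-1) ℕ.+ suc q         ≡⟨ ℕₚ.+-suc _ q ⟩
      suc (count (q ℕ.* p ℕ.+ p-1) ℕ.+ q)       ≡⟨ cong suc (count-+ q p-1 ℕₚ.≤-refl) ⟩
      suc (q ℕ.* p ℕ.+ p-1)                     ≡⟨ shift ⟨
      p ℕ.+ q ℕ.* p ℕ.+ 0                       ∎
      where
      open ≡.≡-Reasoning
      shift′ : p ℕ.+ q ℕ.* p ≡ suc (q ℕ.* p ℕ.+ p-1)
      shift′ = cong suc (ℕₚ.+-comm p-1 (q ℕ.* p))
      shift : p ℕ.+ q ℕ.* p ℕ.+ 0 ≡ suc (q ℕ.* p ℕ.+ p-1)
      shift = ≡.trans (ℕₚ.+-identityʳ _) shift′
    count-+ q       (suc i) i<p = begin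
      count (q ℕ.* p ℕ.+ suc i) ℕ.+ q     ≡⟨ cong (λ n → count n ℕ.+ q) (ℕₚ.+-suc (q ℕ.* p) i) ⟩
      count (suc (q ℕ.* p ℕ.+ i)) ℕ.+ q   ≡⟨ cong (ℕ._+ q) (count-coprime _ p∤) ⟩
      suc (count (q ℕ.* p ℕ.+ i) ℕ.+ q)   ≡⟨ cong suc (count-+ q i (ℕₚ.<⇒≤ i<p)) ⟩
      suc (q ℕ.* p ℕ.+ i)                 ≡⟨ ℕₚ.+-suc (q ℕ.* p) i ⟨
      q ℕ.* p ℕ.+ suc i                   ∎
      where
      open ≡.≡-Reasoning
      p∤ : ¬ p ℕᵈ.∣ suc (q ℕ.* p ℕ.+ i)
      p∤ p∣ = ℕₚ.<⇒≱ i<p (ℕᵈ.∣⇒≤ (ℕᵈ.∣m+n∣m⇒∣n (subst (p ℕᵈ.∣_) (≡.sym (ℕₚ.+-suc (q ℕ.* p) i)) p∣) (ℕᵈ.n∣m*n q)))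

  -- The additive form avoids truncated subtraction and is how the exponent enters the congruence.
  φ-prime^ : φ s ℕ.+ p ℕ.^ j ≡ s
  φ-prime^ = begin
    count s ℕ.+ p ℕ.^ j                        ≡⟨ cong (λ n → count n ℕ.+ p ℕ.^ j) shift ⟩
    count (p ℕ.^ j ℕ.* p ℕ.+ 0) ℕ.+ p ℕ.^ j    ≡⟨ count-+ (p ℕ.^ j) 0 (s≤s z≤n) ⟩
    p ℕ.^ j ℕ.* p ℕ.+ 0                        ≡⟨ shift ⟨
    s                                          ∎
    where
    open ≡.≡-Reasoning
    shift : s ≡ p ℕ.^ j ℕ.* p ℕ.+ 0
    shift = ≡.trans (ℕₚ.*-comm p (p ℕ.^ j)) (≡.sym (ℕₚ.+-identityʳ _))

-- The congruence

fibotomic⇒factorList : ∀ {n P} → 2 ≤ n → IsFibotomic n P → ∃ λ Qs → P ≋ prodₚ Qs × FactorList n Qs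
fibotomic⇒factorList (s≤s ()) (inj₁ (refl , _))
fibotomic⇒factorList _ (inj₂ (_ , Qs , P≈ , irr , distinct , new)) = Qs , ≈ₚ⇒PolyEq P≈ , irr , distinct , new

-- The exponent enters only through `e + p^j = p^(j+1)`; the totient is substituted for `e` at the
-- end.
module _ {p} (pr : Prime p) (j e : ℕ) (e+r≡s : e ℕ.+ p ℕ.^ j ≡ p ℕ.^ suc j)
         {N ψ} (ψ-lists : FactorLists N ψ) where
  private
    module P = CommutativeRing (polyRing p)
    r = p ℕ.^ j
    s = p ℕ.^ suc j
    Ψ : ℕ → Poly
    Ψ n = prodₚ (ψ n)

    1≤s : 1 ≤ s
    1≤s = m^n>0 pr (suc j)

    n≤s*n : ∀ n → n ≤ s ℕ.* n
    n≤s*n n = ℕₚ.m≤n*m n s {{ℕₚ.m^n≢0 p (suc j) {{prime⇒nonZero pr}}}}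

    r*n≤s*n : ∀ n → r ℕ.* n ≤ s ℕ.* n
    r*n≤s*n n = ℕₚ.*-monoˡ-≤ n (ℕₚ.m≤n*m r p {{prime⇒nonZero pr}})

    -- In the two-part list of divisors of `s m`, the first part multiplies to `F (r m)`.
    F-step : ∀ m {ds} → 1 ≤ m → s ℕ.* m ≤ N → ¬ p ℕᵈ.∣ m → IsDivisorList ds m →
      F (s ℕ.* m) ≋ F (r ℕ.* m) *ₚ Π ψ (map (s ℕ.*_) ds)
    F-step m {ds} 1≤m sm≤N p∤m isDiv = begin
      F (s ℕ.* m)                                   ≈⟨ F≋Π ψ-lists 1≤sm sm≤N (isDivisorList-prime^* pr j p∤m isDiv′ isDiv) ⟩
      Π ψ (divisorsOf (r ℕ.* m) ++ map (s ℕ.*_) ds) ≈⟨ Π-++ ψ (divisorsOf (r ℕ.* m)) (map (s ℕ.*_) ds) ⟩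
      Π ψ (divisorsOf (r ℕ.* m)) *ₚ Π ψ (map (s ℕ.*_) ds)
        ≈⟨ ≋.*-congʳ {Π ψ (map (s ℕ.*_) ds)} (F≋Π ψ-lists 1≤rm (ℕₚ.≤-trans (r*n≤s*n m) sm≤N) isDiv′) ⟨
      F (r ℕ.* m) *ₚ Π ψ (map (s ℕ.*_) ds)          ∎
      where
      open ≋-Reasoning
      1≤sm = ℕₚ.*-mono-≤ 1≤s 1≤m
      1≤rm = ℕₚ.*-mono-≤ (m^n>0 pr j) 1≤m
      isDiv′ = isDivisorList (r ℕ.* m) 1≤rm

    Π-cong : ∀ ds → (∀ {d} → d ∈ ds → PolyEq p (Ψ (s ℕ.* d)) (Ψ d ^ₚ e)) →
      PolyEq p (Π ψ (map (s ℕ.*_) ds)) (Π ψ ds ^ₚ e)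
    Π-cong []       h = reduce (≋.sym (one-^ₚ e))
    Π-cong (d ∷ ds) h = P.trans (P.*-cong (h (here refl)) (Π-cong ds (h ∘ there))) (reduce (≋.sym (*ₚ-^ₚ (Ψ d) (Π ψ ds) e)))

    Ψ-s : s ≤ N → F s ≋ F r *ₚ Ψ (s ℕ.* 1)
    Ψ-s s≤N = begin
      F s                                       ≡⟨ cong F (ℕₚ.*-identityʳ s) ⟨
      F (s ℕ.* 1)                               ≈⟨ F-step 1 ℕₚ.≤-refl (subst (_≤ N) (≡.sym (ℕₚ.*-identityʳ s)) s≤N) (prime∤1 pr) isDivisorList-1 ⟩
      F (r ℕ.* 1) *ₚ (Ψ (s ℕ.* 1) *ₚ oneₚ)      ≈⟨ ≋.*-cong (≋.reflexive (cong F (ℕₚ.*-identityʳ r))) (≋.*-identityʳ (Ψ (s ℕ.* 1))) ⟩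
      F r *ₚ Ψ (s ℕ.* 1)                        ∎
      where open ≋-Reasoning

  -- Strong induction with `m ≤ M`. The product over all divisors of `m` is known from `H≈`;
  -- dividing out the proper divisors, by induction, and the exceptional index 1 isolates the index
  -- `m`.
  fibotomic-congruence : ∀ M m → m ≤ M → 2 ≤ m → s ℕ.* m ≤ N → ¬ p ℕᵈ.∣ m → PolyEq p (Ψ (s ℕ.* m)) (Ψ m ^ₚ e)
  fibotomic-congruence zero    zero _ () _ _
  fibotomic-congruence (suc M) m m≤M 2≤m sm≤N p∤m =
    *ₚ-cancelˡ nzd (u *ₚ R ^ₚ e) (monic≉0-mod {P = u *ₚ R ^ₚ e} pr (monic-* {u} {R ^ₚ e} u-monic (^ₚ-monic R e R-monic))) (begin
      u *ₚ R ^ₚ e *ₚ Ψ (s ℕ.* m)           ≈⟨ reduce (lem₁ u (R ^ₚ e) (Ψ (s ℕ.* m))) ⟩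
      -- The induction hypothesis converts the proper divisors inside `H` into `R ^ₚ e`, while the
      -- divisor 1 contributes `u` unchanged.
      Ψ (s ℕ.* m) *ₚ (u *ₚ R ^ₚ e)         ≈⟨ P.*-congˡ {Ψ (s ℕ.* m)} (P.*-congˡ {u} (Π-cong (properDivisors m) IH)) ⟨
      H                                    ≈⟨ H≈ ⟨
      u *ₚ F m ^ₚ e                        ≈⟨ reduce (≋.*-congˡ {u} (≋.trans (^ₚ-cong e Fm≋) (*ₚ-^ₚ (Ψ m) R e))) ⟩
      u *ₚ (Ψ m ^ₚ e *ₚ R ^ₚ e)            ≈⟨ reduce (lem₂ u (Ψ m ^ₚ e) (R ^ₚ e)) ⟩
      u *ₚ R ^ₚ e *ₚ Ψ m ^ₚ e              ∎)
    where
    open SetoidReasoning (polySetoid {p})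
    nzd = prime⇒noZeroDivisors pr
    1≤m : 1 ≤ m
    1≤m = ℕₚ.<⇒≤ 2≤m
    m≤N : m ≤ N
    m≤N = ℕₚ.≤-trans (n≤s*n m) sm≤N
    s*1≤N : s ℕ.* 1 ≤ N
    s*1≤N = ℕₚ.≤-trans (ℕₚ.*-monoʳ-≤ s 1≤m) sm≤N
    u = Ψ (s ℕ.* 1)
    R = Π ψ (properDivisors m)
    H = Π ψ (map (s ℕ.*_) (m ∷ 1 ∷ properDivisors m))
    isDiv = isDivisorList-≥2 2≤m

    IH : ∀ {d} → d ∈ properDivisors m → PolyEq p (Ψ (s ℕ.* d)) (Ψ d ^ₚ e)
    IH d∈ with properDivisors-∈ {n = m} d∈
    ... | 2≤d , d<m , d∣m = fibotomic-congruence M _ (ℕₚ.≤-pred (ℕₚ.≤-trans d<m m≤M)) 2≤d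
      (ℕₚ.≤-trans (ℕₚ.*-monoʳ-≤ s (ℕₚ.<⇒≤ d<m)) sm≤N) (λ p∣d → p∤m (ℕᵈ.∣-trans p∣d d∣m))

    u-monic : Monic u
    u-monic = prod-monic (ψ (s ℕ.* 1)) (proj₁ (ψ-lists (s ℕ.* 1) (ℕₚ.*-mono-≤ 1≤s ℕₚ.≤-refl) s*1≤N))
    R-monic : Monic R
    R-monic = Π-monic ψ-lists (properDivisors m) λ d∈ →
      let (2≤d , d<m , _) = properDivisors-∈ {n = m} d∈ in ℕₚ.<⇒≤ 2≤d , ℕₚ.≤-trans (ℕₚ.<⇒≤ d<m) m≤N

    F-monic′ : ∀ n → 1 ≤ n → Monic (F n)
    F-monic′ (suc n) _ = n , F-monic n

    Ψ1≋1 : Ψ 1 ≋ oneₚ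
    Ψ1≋1 = ≋.sym (≋.trans (F≋Π ψ-lists ℕₚ.≤-refl (ℕₚ.≤-trans 1≤m m≤N) isDivisorList-1) (≋.*-identityʳ (Ψ 1)))
    Fm≋ : F m ≋ Ψ m *ₚ R
    Fm≋ = ≋.trans (F≋Π ψ-lists 1≤m m≤N isDiv) (≋.*-congˡ {Ψ m} (≋.trans (≋.*-congʳ {R} Ψ1≋1) (≋.*-identityˡ R)))

    lem₁ : ∀ u R A → u *ₚ R *ₚ A ≋ A *ₚ (u *ₚ R)
    lem₁ = solve-∀ ℤ[x]
    lem₂ : ∀ u A R → u *ₚ (A *ₚ R) ≋ u *ₚ R *ₚ A
    lem₂ = solve-∀ ℤ[x]
    lem₃ : ∀ f g u a → f *ₚ g *ₚ (u *ₚ a) ≋ f *ₚ u *ₚ (a *ₚ g)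
    lem₃ = solve-∀ ℤ[x]

    -- Multiplied by `F r · (F m)^r`, both sides are congruent to `F (s m)`: one through
    -- `F s = F r · u` and `e + r = s`, the other through the divisors of `s m`.
    H≈ : PolyEq p (u *ₚ F m ^ₚ e) H
    H≈ = *ₚ-cancelˡ nzd (F r *ₚ F m ^ₚ r)
      (monic≉0-mod {P = F r *ₚ F m ^ₚ r} pr (monic-* {F r} {F m ^ₚ r} (F-monic′ r (m^n>0 pr j)) (^ₚ-monic (F m) r (F-monic′ m 1≤m)))) (begin
        F r *ₚ F m ^ₚ r *ₚ (u *ₚ F m ^ₚ e)   ≈⟨ reduce (lem₃ (F r) (F m ^ₚ r) u (F m ^ₚ e)) ⟩
        F r *ₚ u *ₚ (F m ^ₚ e *ₚ F m ^ₚ r)   ≈⟨ reduce (≋.*-cong (Ψ-s (subst (_≤ N) (ℕₚ.*-identityʳ s) s*1≤N)) (^ₚ-+ (F m) e r)) ⟨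
        F s *ₚ F m ^ₚ (e ℕ.+ r)              ≡⟨ cong (λ t → F s *ₚ F m ^ₚ t) e+r≡s ⟩
        F s *ₚ F m ^ₚ s                      ≈⟨ F-prime^* pr (suc j) m 1≤m ⟨
        F (s ℕ.* m)                          ≈⟨ reduce (F-step m 1≤m sm≤N p∤m isDiv) ⟩
        F (r ℕ.* m) *ₚ H                     ≈⟨ P.*-congʳ {H} (F-prime^* pr j m 1≤m) ⟩
        F r *ₚ F m ^ₚ r *ₚ H                 ∎)

PolyEq⇒CongMod : ∀ {p P Q} → PolyEq p P Q → CongMod p P Q
PolyEq⇒CongMod e i = ∣⇒∣ᵤ (ModEq.diff (at e i))

theorem5p2 : (p m k : ℕ) → Prime p → 2 ≤ m → gcd p m ≡ 1 →
    (P Q : Poly) → IsFibotomic ((p ^ k) * m) P → IsFibotomic m Q →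
    CongMod p P (Q ^ₚ φ (p ^ k))
-- For `k = 0` the exponent `φ 1` computes to 1 and uniqueness of the fibotomic polynomial suffices.
theorem5p2 p m zero pr 2≤m _ P Q fibP fibQ
  with fibotomic⇒factorList 2≤m (subst (λ n → IsFibotomic n P) (ℕₚ.*-identityˡ m) fibP) | fibotomic⇒factorList 2≤m fibQ
... | As , P≋ , a | Bs , Q≋ , b = PolyEq⇒CongMod {p} {P} {Q ^ₚ 1} (reduce (≋.trans P≋ (≋.trans (factorList-unique a b)
  (≋.trans (≋.sym Q≋) (≋.sym (≋.*-identityʳ Q))))))
theorem5p2 p@(suc _) m (suc j) pr 2≤m gcd≡1 P Q fibP fibQ i =
  -- With the coefficient index `i` fixed the goal is a single decidable divisibility, so the doubly
  -- negated lists may be used.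
  decidable-stable (p ℕᵈ.∣? _) (¬¬-map (λ { (ψ , lists) → PolyEq⇒CongMod {p} {P} {Q ^ₚ φ (p ^ suc j)} (congruence lists) i }) (factorLists N))
  where
  N = p ^ suc j * m
  m≤N : m ≤ N
  m≤N = ℕₚ.m≤n*m m (p ^ suc j) {{ℕₚ.m^n≢0 p (suc j)}}
  p∤m : ¬ p ℕᵈ.∣ m
  p∤m p∣m = prime∤1 pr (subst (p ℕᵈ.∣_) gcd≡1 (gcd-greatest ℕᵈ.∣-refl p∣m))
  congruence : ∀ {ψ} → FactorLists N ψ → PolyEq p P (Q ^ₚ φ (p ^ suc j))
  congruence {ψ} lists with fibotomic⇒factorList (ℕₚ.≤-trans 2≤m m≤N) fibP | fibotomic⇒factorList 2≤m fibQ
  ... | As , P≋ , a | Bs , Q≋ , b = begin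
    P                              ≈⟨ reduce (≋.trans P≋ (factorList-unique a (lists N (ℕₚ.<⇒≤ (ℕₚ.≤-trans 2≤m m≤N)) ℕₚ.≤-refl))) ⟩
    prodₚ (ψ N)                    ≈⟨ fibotomic-congruence pr j (φ (p ^ suc j)) (φ-prime^ pr j) lists m m ℕₚ.≤-refl 2≤m ℕₚ.≤-refl p∤m ⟩
    prodₚ (ψ m) ^ₚ φ (p ^ suc j)   ≈⟨ ^ₚ-cong (φ (p ^ suc j)) (reduce (≋.trans Q≋ (factorList-unique b (lists m (ℕₚ.<⇒≤ 2≤m) m≤N)))) ⟨
    Q ^ₚ φ (p ^ suc j)             ∎
    where open SetoidReasoning (polySetoid {p})
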